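{- Let $k\geq 7$ be an odd integer and let $T\in\mathcal{D}_k\setminus\mathcal{D}_{k-2}$. Then $T$ is switching equivalent to a transitive blowup of $L_{k+1}$ if and only if $T\in\xi(L_{k+1})$, i.e. if and only if $T$ contains a subtournament which is switching isomorphic to $L_{k+1}$.
   Context: A tournament is a digraph with exactly one arc between each pair of distinct vertices. Skew-adjacency matrix $S_T$ w.r.t. an ordering $v_1,\dots,v_n$: entry $1$ if $v_i\to v_j$, $-1$ if $v_j\to v_i$, $0$ on the diagonal; $\det(T)=\det(S_T)$. For odd $k\ge1$, $\mathcal{D}_k$ is the set of tournaments all of whose induced subtournaments have determinant at most $k^2$; $T\in\mathcal{D}_k\setminus\mathcal{D}_{k-2}$ means $T\in\mathcal{D}_k$ and $T\notin\mathcal{D}_{k-2}$. The switch of $T$ with respect to $W\subseteq V(T)$ reverses all arcs between $W$ and $V(T)\setminus W$; $T$ and its switches are switching equivalent; $T_1$ is switching isomorphic to $T_2$ if some switch of $T_1$ is isomorphic to $T_2$. $\xi(H)$ denotes the set of tournaments containing a subtournament switching isomorphic to $H$. For $n\ge2$, $L_n$ is the $n$-tournament on $v_1,\dots,v_n$ with $v_i\to v_j$ for $1\le i<j\le n-1$, and for $1\le i\le n-1$, $v_n\to v_i$ if $i$ is odd, $v_i\to v_n$ if $i$ is even. A transitive blowup of a tournament $H$ on $h_1,\dots,h_m$ replaces each $h_i$ by a transitive tournament on $a_i\ge1$ vertices with all arcs from block $i$ to block $j$ whenever $h_i\to h_j$. "$T$ is switching equivalent to a transitive blowup of $H$" means some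 switch of $T$ is isomorphic to a transitive blowup of $H$. -}

module Defs where

open import Data.Nat using (ℕ; zero; suc; _<ᵇ_; _≤_; _*_)
open import Data.Nat.Properties using ()
open import Data.Fin using (Fin; zero; suc; toℕ; fromℕ; inject₁; punchIn; opposite)
open import Data.Bool using (Bool; true; false; not; _xor_; if_then_else_)
open import Data.Integer as ℤ using (ℤ; +_; -_)
open import Data.Product using (Σ; ∃; ∃-syntax; _×_; _,_)
open import Relation.Binary.PropositionalEquality using (_≡_; _≢_; refl; sym; trans; cong)
open import Data.Nat using (_≟_)
open import Relation.Nullary using (yes; no)
open import Data.Empty using (⊥-elim)
open import Data.Fin.Properties using (toℕ-injective)
open import Data.Bool.Properties using (not-involutive)
open import Relation.Nullary using (¬_)
open import Function using (Injective; _∘_)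
open import Function.Definitions using (Surjective)

-- A tournament on vertex set Fin n: arc i j = true means i → j.
record Tournament (n : ℕ) : Set where
  field
    arc     : Fin n → Fin n → Bool
    irrefl  : ∀ i → arc i i ≡ false
    oneArc  : ∀ i j → i ≢ j → arc i j ≡ not (arc j i)
open Tournament public

Matrix : ℕ → Set
Matrix n = Fin n → Fin n → ℤ

altSum : ∀ {n} → (Fin n → ℤ) → ℤ
altSum {zero}  f = + 0
altSum {suc n} f = f zero ℤ.- altSum (f ∘ suc)

det : ∀ {n} → Matrix n → ℤ
det {zero}  M = + 1
det {suc n} M = altSum (λ j → M zero j ℤ.* det (λ r c → M (suc r) (punchIn j c)))

skew : ∀ {n} → Tournament n → Matrix n
skew T i j = if arc T i j then + 1 else (if arc T j i then - (+ 1) else + 0)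

detT : ∀ {n} → Tournament n → ℤ
detT T = det (skew T)

induced : ∀ {m n} (T : Tournament n) (f : Fin m → Fin n) → Injective _≡_ _≡_ f → Tournament m
induced T f inj = record
  { arc    = λ i j → arc T (f i) (f j)
  ; irrefl = λ i → irrefl T (f i)
  ; oneArc = λ i j i≢j → oneArc T (f i) (f j) (λ e → i≢j (inj e))
  }

InD : ∀ {n} → ℕ → Tournament n → Set
InD {n} k T = ∀ m (f : Fin m → Fin n) (inj : Injective _≡_ _≡_ f) →
  detT (induced T f inj) ℤ.≤ + (k * k)

switch : ∀ {n} → Tournament n → (Fin n → Bool) → Tournament n
switch T W = record
  { arc    = λ i j → arc T i j xor (W i xor W j)
  ; irrefl = irr
  ; oneArc = one
  }
  where
  open import Data.Bool.Properties using (xor-same; xor-identityʳ; not-distribˡ-xor; xor-comm)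
  irr : ∀ i → arc T i i xor (W i xor W i) ≡ false
  irr i rewrite xor-same (W i) | xor-identityʳ (arc T i i) = irrefl T i
  one : ∀ i j → i ≢ j → arc T i j xor (W i xor W j) ≡ not (arc T j i xor (W j xor W i))
  one i j ne rewrite oneArc T i j ne | xor-comm (W j) (W i) = sym (not-distribˡ-xor (arc T j i) (W i xor W j))

Isomorphic : ∀ {n m} → Tournament n → Tournament m → Set
Isomorphic {n} {m} T₁ T₂ =
  Σ (Fin n → Fin m) λ σ → Injective _≡_ _≡_ σ × Surjective _≡_ _≡_ σ ×
    (∀ i j → arc T₂ (σ i) (σ j) ≡ arc T₁ i j)

SwitchingIsomorphic : ∀ {n m} → Tournament n → Tournament m → Set
SwitchingIsomorphic {n} T₁ T₂ = Σ (Fin n → Bool) λ W → Isomorphic (switch T₁ W) T₂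

InXi : ∀ {n h} → Tournament h → Tournament n → Set
InXi {n} {h} H T = Σ (Fin h → Fin n) λ f → Σ (Injective _≡_ _≡_ f) λ inj →
  SwitchingIsomorphic (induced T f inj) H

-- L_{m+2} on vertices v_1..v_{m+2} ↦ Fin (suc (suc m)); v_i ↦ index i-1,
-- so v_n is the last index (toℕ = suc m).
-- Among v_1..v_{n-1}: v_i → v_j iff i < j.  v_n → v_i iff i odd,
-- i.e. iff the 0-based index toℕ of v_i is even.
evenᵇ : ℕ → Bool
evenᵇ zero = true
evenᵇ (suc k) = not (evenᵇ k)

Larc : ∀ m → Fin (suc (suc m)) → Fin (suc (suc m)) → Bool
Larc m i j with toℕ i ≟ suc m | toℕ j ≟ suc m
... | yes _ | yes _ = false
... | yes _ | no _  = evenᵇ (toℕ j)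
... | no _  | yes _ = not (evenᵇ (toℕ i))
... | no _  | no _  = toℕ i <ᵇ toℕ j

private
  Lirr : ∀ m i → Larc m i i ≡ false
  Lirr m i with toℕ i ≟ suc m
  ... | yes _ = refl
  ... | no _  = <ᵇ-irr (toℕ i)
    where
    <ᵇ-irr : ∀ k → (k <ᵇ k) ≡ false
    <ᵇ-irr zero = refl
    <ᵇ-irr (suc k) = <ᵇ-irr k

  <ᵇ-tri : ∀ a b → a ≢ b → (a <ᵇ b) ≡ not (b <ᵇ a)
  <ᵇ-tri zero zero ne = ⊥-elim (ne refl)
  <ᵇ-tri zero (suc b) ne = refl
  <ᵇ-tri (suc a) zero ne = refl
  <ᵇ-tri (suc a) (suc b) ne = <ᵇ-tri a b (λ e → ne (cong suc e))

  Lone : ∀ m i j → i ≢ j → Larc m i j ≡ not (Larc m j i)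
  Lone m i j ne with toℕ i ≟ suc m | toℕ j ≟ suc m
  ... | yes p | yes q = ⊥-elim (ne (toℕ-injective (trans p (sym q))))
  ... | yes _ | no _  = sym (not-involutive _)
  ... | no _  | yes _ = refl
  ... | no _  | no _  = <ᵇ-tri (toℕ i) (toℕ j) (λ e → ne (toℕ-injective e))

L : ∀ m → Tournament (suc (suc m))
L m = record { arc = Larc m ; irrefl = Lirr m ; oneArc = Lone m }

-- T (on Fin n) is a transitive blowup of H (on Fin h) — up to relabeling of
-- T's vertices: there is a surjective block map b (each block nonempty),
-- arcs between different blocks follow H, and within each block the arcs
-- form a transitive tournament.
IsTransitiveBlowupOf : ∀ {n h} → Tournament h → Tournament n → Set
IsTransitiveBlowupOf {n} {h} H T = Σ (Fin n → Fin h) λ b →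
  Surjective _≡_ _≡_ b ×
  (∀ u v → b u ≢ b v → arc T u v ≡ arc H (b u) (b v)) ×
  (∀ u v w → b u ≡ b v → b v ≡ b w →
     arc T u v ≡ true → arc T v w ≡ true → arc T u w ≡ true)

SwitchingEquivToTransitiveBlowup : ∀ {n h} → Tournament h → Tournament n → Set
SwitchingEquivToTransitiveBlowup {n} {h} H T =
  Σ (Fin n → Bool) λ W → Σ ℕ λ N → Σ (Tournament N) λ B →
    IsTransitiveBlowupOf H B × Isomorphic (switch T W) B

{-# OPTIONS --safe #-}

-- Switch T so that its copy of L_{k+1} becomes circulant: vertices c₀, …, c_{k-1} with skew entries
-- (-1)^(j-i) for i < j, all dominated by a further vertex q.  For an even sublist e of the cᵢ with
-- alternating indices the determinant of e ∪ {u, v} is the square of an explicit bilinear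
-- expression.  For u = q and v = x it is ± 1 − Σ_{i<j} (bⱼ − bᵢ), where b is the ±1 word of x along
-- e.  Comparing the values for two cuts of the cyclic word of x with the bound k shows that this
-- word is constant or has exactly one pair of equal cyclic neighbours, so that x is, up to
-- switching, a twin of q or of some cᵢ.  After switching all signs away, a wrong arc between twins
-- of different vertices gives a Pfaffian of the form Y ± 2k with |Y| < k, and a cyclic triangle of
-- twins of one vertex gives the Pfaffian ± 3k.
module Submission where

open import Defs
open import Data.Nat as ℕ using (ℕ; zero; suc; _∸_)
import Data.Nat.Properties as ℕ
open import Data.Fin using (Fin; zero; suc; toℕ; fromℕ; fromℕ<; inject₁; punchIn; punchOut)
open import Data.Fin.Properties using (_≟_; any?; suc-injective; toℕ-injective; toℕ-inject₁; toℕ-fromℕ; toℕ-fromℕ<; toℕ<n; punchInᵢ≢i; punchIn-injective; punchIn-punchOut)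
open import Data.Fin.Relation.Unary.Top using (view; ‵fromℕ; ‵inject₁)
open import Data.Integer using (ℤ; +_; -[1+_]; -_; _+_; _*_; _-_; 0ℤ; 1ℤ; -1ℤ; _≤_; _<_; +≤+; -≤+; +<+; drop‿+≤+)
import Data.Integer.Properties as ℤ
open import Data.Integer.Tactic.RingSolver using (solve-∀)
open import Data.Product using (∃; _×_; _,_; proj₁; proj₂)
open import Data.Sum using (_⊎_; inj₁; inj₂)
open import Data.Empty using (⊥; ⊥-elim)
open import Data.Bool as Bool using (Bool; true; false; not; _xor_)
open import Data.Bool.Properties using (not-involutive; not-injective; ¬-not; xor-same; xor-identityʳ)
open import Data.Bool.Solver using (module xor-∧-Solver)
open import Data.List using (List; []; _∷_; _++_; length; map; lookup; tabulate; initLast; _∷ʳ′_)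
open import Data.List.Properties using (++-assoc; ++-identityʳ; ∷-injective; ∷-injectiveʳ; length-map; length-tabulate; map-++)
open import Data.List.Relation.Unary.All as All using (All; []; _∷_)
import Data.List.Relation.Unary.All.Properties as All
open import Data.List.Relation.Unary.AllPairs using (AllPairs; []; _∷_)
import Data.List.Relation.Unary.AllPairs.Properties as AllPairs
open import Data.List.Relation.Unary.Any using (here; there)
open import Data.List.Membership.Propositional using (_∈_)
open import Data.List.Membership.Propositional.Properties using (∈-∃++; ∈-lookup; ∈-++⁺ˡ; ∈-++⁺ʳ; ∈-++⁻; ∈-tabulate⁺; ∈-tabulate⁻)
open import Data.List.Relation.Binary.Permutation.Propositional as ↭ using (_↭_; ↭-refl; ↭-sym; ↭-trans)
import Data.List.Relation.Binary.Permutation.Propositional.Properties as ↭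
open import Function using (_∘_; Injective; id)
open import Function.Bundles using (_⇔_; mk⇔)
open import Relation.Nullary using (¬_; yes; no)
open import Relation.Binary.Definitions using (tri<; tri≈; tri>)
open import Relation.Binary.PropositionalEquality
open import Relation.Binary.PropositionalEquality using () renaming (trans to _▹_)

-- Determinants

-- A determinant that is a square `y * y` is bounded by `k * k` exactly when `|y| ≤ k`, so the
-- hypothesis becomes a linear condition on the bilinear expressions, and two of their values differ
-- by at most `2k`. For two cuts of the cyclic word the difference involves only `k` and the sum of
-- the word. Every cut is available because a circle of odd length rotates without a change of
-- signs; oddness also makes the sum of the word non-zero.
--
-- The constants `2k` and `3k` have one source. The copy of `L_{k+1}` itself has Pfaffian `± k`. If
-- `a` and `b` are twins of a vertex `p` of the copy, pivoting on them and completing the remaining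
-- frame by `v` gives the Pfaffian with `v` in the place of `p`, plus `ω a v - ω b v` times the
-- Pfaffian of the copy. A vertex `v` that tells `a` from `b` makes this factor `± 2`. If `v` is a
-- third twin of `p`, the first term is itself `± k`, with the same sign for a cyclic triangle. If
-- `v` is a twin of another vertex `p′`, the first term would vanish with `v` replaced by `p′`, a
-- repeated vertex; only the entry between `p′` and `v` survives, which keeps its modulus below `k`.

altSum-cong : ∀ {n} {f g : Fin n → ℤ} → (∀ j → f j ≡ g j) → altSum f ≡ altSum g
altSum-cong {zero}  e = refl
altSum-cong {suc n} e = cong₂ _-_ (e zero) (altSum-cong (e ∘ suc))

altSum-zero : ∀ {n} {f : Fin n → ℤ} → (∀ j → f j ≡ 0ℤ) → altSum f ≡ 0ℤ
altSum-zero {zero}  e = refl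
altSum-zero {suc n} e rewrite e zero | altSum-zero (e ∘ suc) = refl

altSum-linear : ∀ {n} t (f g : Fin n → ℤ) → altSum (λ j → f j + t * g j) ≡ altSum f + t * altSum g
altSum-linear {zero}  t f g = sym (trans (ℤ.+-identityˡ _) (ℤ.*-zeroʳ t))
altSum-linear {suc n} t f g rewrite altSum-linear t (f ∘ suc) (g ∘ suc) =
  lem t (f zero) (g zero) (altSum (f ∘ suc)) (altSum (g ∘ suc))
  where
  lem : ∀ t a b c d → (a + t * b) - (c + t * d) ≡ (a - c) + t * (b - d)
  lem = solve-∀

altSum-adjacent : ∀ {n} (i : Fin n) (f : Fin (suc n) → ℤ) → f (inject₁ i) ≡ f (suc i) →
  (∀ j → j ≢ inject₁ i → j ≢ suc i → f j ≡ 0ℤ) → altSum f ≡ 0ℤ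
altSum-adjacent {suc n} zero f e z
  rewrite e | altSum-zero {f = λ j → f (suc (suc j))} (λ j → z (suc (suc j)) (λ ()) (λ ())) = lem (f (suc zero))
  where
  lem : ∀ a → a - (a - 0ℤ) ≡ 0ℤ
  lem = solve-∀
altSum-adjacent {suc n} (suc i) f e z
  rewrite z zero (λ ()) (λ ())
        | altSum-adjacent i (f ∘ suc) e (λ j a b → z (suc j) (a ∘ suc-injective) (b ∘ suc-injective)) = refl

minor : ∀ {n} → Fin (suc n) → Matrix (suc n) → Matrix n
minor j M r c = M (suc r) (punchIn j c)

det-cong : ∀ {n} {M N : Matrix n} → (∀ i j → M i j ≡ N i j) → det M ≡ det N
det-cong {zero}  e = refl
det-cong {suc n} e =
  altSum-cong (λ j → cong₂ _*_ (e zero j) (det-cong (λ r c → e (suc r) (punchIn j c))))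

-- Formulated for three matrices that agree off column `p`, so that the induction applies to minors,
-- where that column has moved to `punchOut j≢p`.
det-linear : ∀ {n} (p : Fin n) (t : ℤ) {K M N : Matrix n} →
  (∀ i j → j ≢ p → K i j ≡ M i j) → (∀ i j → j ≢ p → N i j ≡ M i j) →
  (∀ i → K i p ≡ M i p + t * N i p) → det K ≡ det M + t * det N
det-linear {suc n} p t {K} {M} {N} km nm kp =
  trans (altSum-cong term) (altSum-linear t (λ j → M zero j * det (minor j M)) (λ j → N zero j * det (minor j N)))
  where
  lemp : ∀ t a b d → (a + t * b) * d ≡ a * d + t * (b * d)
  lemp = solve-∀
  lemj : ∀ t a d e → a * (d + t * e) ≡ a * d + t * (a * e)
  lemj = solve-∀
  off : ∀ {j} (j≢p : j ≢ p) c → c ≢ punchOut j≢p → punchIn j c ≢ p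
  off {j} j≢p c c≢ e = c≢ (punchIn-injective j c _ (trans e (sym (punchIn-punchOut j≢p))))
  term : ∀ j → K zero j * det (minor j K) ≡
    M zero j * det (minor j M) + t * (N zero j * det (minor j N))
  term j with j ≟ p
  ... | yes refl
    rewrite kp zero
          | det-cong {M = minor j K} {minor j M} (λ r c → km (suc r) (punchIn j c) (punchInᵢ≢i j c))
          | det-cong {M = minor j N} {minor j M} (λ r c → nm (suc r) (punchIn j c) (punchInᵢ≢i j c))
    = lemp t (M zero j) (N zero j) (det (minor j M))
  ... | no j≢p
    rewrite km zero j j≢p | nm zero j j≢p
          | det-linear (punchOut j≢p) t {minor j K} {minor j M} {minor j N}
              (λ i c c≢ → km (suc i) (punchIn j c) (off j≢p c c≢))
              (λ i c c≢ → nm (suc i) (punchIn j c) (off j≢p c c≢))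
              (λ i → subst (λ q → K (suc i) q ≡ M (suc i) q + t * N (suc i) q)
                       (sym (punchIn-punchOut j≢p)) (kp (suc i)))
    = lemj t (M zero j) (det (minor j M)) (det (minor j N))

punchIn-adjacent : ∀ {n} (i : Fin (suc n)) (j : Fin (suc (suc n))) → j ≢ inject₁ i → j ≢ suc i →
  ∃ λ i′ → punchIn j (inject₁ i′) ≡ inject₁ i × punchIn j (suc i′) ≡ suc i
punchIn-adjacent zero zero a b = ⊥-elim (a refl)
punchIn-adjacent zero (suc zero) a b = ⊥-elim (b refl)
punchIn-adjacent {suc n} zero (suc (suc j)) a b = zero , refl , refl
punchIn-adjacent (suc i) zero a b = i , refl , refl
punchIn-adjacent {suc n} (suc i) (suc j) a b
  with i′ , p , q ← punchIn-adjacent i j (a ∘ cong suc) (b ∘ cong suc) =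
  suc i′ , cong suc p , cong suc q

punchIn-inject₁-suc : ∀ {n} (i x : Fin n) → punchIn (inject₁ i) x ≡ punchIn (suc i) x ⊎
  (punchIn (inject₁ i) x ≡ suc i × punchIn (suc i) x ≡ inject₁ i)
punchIn-inject₁-suc zero zero = inj₂ (refl , refl)
punchIn-inject₁-suc zero (suc x) = inj₁ refl
punchIn-inject₁-suc (suc i) zero = inj₁ refl
punchIn-inject₁-suc (suc i) (suc x) with punchIn-inject₁-suc i x
... | inj₁ e = inj₁ (cong suc e)
... | inj₂ (e , f) = inj₂ (cong suc e , cong suc f)

-- In the expansion along the first row the two equal columns have the same minor and opposite
-- signs; every other minor again has two adjacent equal columns.
det-adjacentEqual : ∀ {n} (i : Fin n) (M : Matrix (suc n)) →
  (∀ r → M r (inject₁ i) ≡ M r (suc i)) → det M ≡ 0ℤ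
det-adjacentEqual {suc n} i M e =
  altSum-adjacent i _
    (cong₂ _*_ (e zero) (det-cong same))
    (λ j a b → trans (cong (M zero j *_) (zeroMinor j a b)) (ℤ.*-zeroʳ (M zero j)))
  where
  same : ∀ r c → minor (inject₁ i) M r c ≡ minor (suc i) M r c
  same r c with punchIn-inject₁-suc i c
  ... | inj₁ q = cong (M (suc r)) q
  ... | inj₂ (q , q′) rewrite q | q′ = sym (e (suc r))
  zeroMinor : ∀ j → j ≢ inject₁ i → j ≢ suc i → det (minor j M) ≡ 0ℤ
  zeroMinor j a b with i′ , p , q ← punchIn-adjacent i j a b =
    det-adjacentEqual i′ (minor j M)
      (λ r → trans (cong (M (suc r)) p) (trans (e (suc r)) (cong (M (suc r)) (sym q))))

setCol : ∀ {n} → Fin n → (Fin n → ℤ) → Matrix n → Matrix n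
setCol p a M i j with j ≟ p
... | yes _ = a i
... | no _  = M i j

setCol-at : ∀ {n} (p : Fin n) a M i → setCol p a M i p ≡ a i
setCol-at p a M i with p ≟ p
... | yes _ = refl
... | no p≢p = ⊥-elim (p≢p refl)

setCol-off : ∀ {n} (p : Fin n) a M i j → j ≢ p → setCol p a M i j ≡ M i j
setCol-off p a M i j j≢p with j ≟ p
... | yes e = ⊥-elim (j≢p e)
... | no _ = refl

det-setCol-+ : ∀ {n} (p : Fin n) t a b (M : Matrix n) →
  det (setCol p (λ i → a i + t * b i) M) ≡ det (setCol p a M) + t * det (setCol p b M)
det-setCol-+ p t a b M = det-linear p t
  (λ i j q → trans (setCol-off p _ M i j q) (sym (setCol-off p _ M i j q)))
  (λ i j q → trans (setCol-off p _ M i j q) (sym (setCol-off p _ M i j q)))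
  (λ i → trans (setCol-at p _ M i)
           (sym (cong₂ (λ u v → u + t * v) (setCol-at p a M i) (setCol-at p b M i))))

inject₁≢suc : ∀ {n} (i : Fin n) → inject₁ i ≢ suc i
inject₁≢suc (suc i) e = inject₁≢suc i (suc-injective e)

module _ {n} (i : Fin n) (M : Matrix (suc n)) where
  private
    G : (x y : Fin (suc n) → ℤ) → Matrix (suc n)
    G x y = setCol (inject₁ i) x (setCol (suc i) y M)

    G-comm : ∀ x y r c → G x y r c ≡ setCol (suc i) y (setCol (inject₁ i) x M) r c
    G-comm x y r c with c ≟ inject₁ i in eq₁ | c ≟ suc i in eq₂
    ... | yes p | yes q = ⊥-elim (inject₁≢suc i (trans (sym p) q))
    ... | yes p | no q rewrite eq₁ = refl
    ... | no p | yes q rewrite eq₂ = refl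
    ... | no p | no q rewrite eq₁ | eq₂ = refl

    G-self : ∀ x → det (G x x) ≡ 0ℤ
    G-self x = det-adjacentEqual i (G x x)
      (λ r → trans (setCol-at (inject₁ i) x _ r)
               (sym (trans (G-comm x x r (suc i)) (setCol-at (suc i) x _ r))))

    G-+ʳ : ∀ x y z → det (G x (λ r → y r + 1ℤ * z r)) ≡ det (G x y) + 1ℤ * det (G x z)
    G-+ʳ x y z = trans (det-cong (G-comm x _))
      (trans (det-setCol-+ (suc i) 1ℤ y z (setCol (inject₁ i) x M))
        (sym (cong₂ (λ u v → u + 1ℤ * v) (det-cong (G-comm x y)) (det-cong (G-comm x z)))))

  -- Polarisation: the determinant with `a + b` in both columns vanishes, and so do the terms with
  -- `a` twice or `b` twice; the two mixed terms remain.
  det-swapAdjacent : ∀ {N} → (∀ r c → c ≢ inject₁ i → c ≢ suc i → N r c ≡ M r c) →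
    (∀ r → N r (inject₁ i) ≡ M r (suc i)) → (∀ r → N r (suc i) ≡ M r (inject₁ i)) →
    det M ≡ - det N
  det-swapAdjacent {N} off e₀ e₁ = lem (det M) (det N) (begin
    det M + det N
      ≡⟨ cong₂ _+_ (det-cong isM) (det-cong isN) ⟩
    det (G a b) + det (G b a)
      ≡⟨ expand (det (G a b)) (det (G b a)) ⟨
    (0ℤ + 1ℤ * det (G a b)) + 1ℤ * (det (G b a) + 1ℤ * 0ℤ)
      ≡⟨ cong₂ (λ u v → (u + 1ℤ * det (G a b)) + 1ℤ * (det (G b a) + 1ℤ * v)) (G-self a) (G-self b) ⟨
    (det (G a a) + 1ℤ * det (G a b)) + 1ℤ * (det (G b a) + 1ℤ * det (G b b))
      ≡⟨ cong₂ (λ u v → u + 1ℤ * v) (G-+ʳ a a b) (G-+ʳ b a b) ⟨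
    det (G a s) + 1ℤ * det (G b s)
      ≡⟨ det-setCol-+ (inject₁ i) 1ℤ a b (setCol (suc i) s M) ⟨
    det (G s s)
      ≡⟨ G-self s ⟩
    0ℤ ∎)
    where
    open ≡-Reasoning
    a b s : Fin (suc n) → ℤ
    a r = M r (inject₁ i)
    b r = M r (suc i)
    s r = a r + 1ℤ * b r
    isM : ∀ r c → M r c ≡ G a b r c
    isM r c with c ≟ inject₁ i
    ... | yes refl = refl
    ... | no _ with c ≟ suc i
    ...   | yes refl = refl
    ...   | no _ = refl
    isN : ∀ r c → N r c ≡ G b a r c
    isN r c with c ≟ inject₁ i
    ... | yes refl = e₀ r
    ... | no p with c ≟ suc i
    ...   | yes refl = e₁ r
    ...   | no q = off r c p q
    expand : ∀ x y → (0ℤ + 1ℤ * x) + 1ℤ * (y + 1ℤ * 0ℤ) ≡ x + y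
    expand = solve-∀
    lem : ∀ x y → x + y ≡ 0ℤ → x ≡ - y
    lem x y e = trans (add-sub x y) (trans (cong (_- y) e) (ℤ.+-identityˡ (- y)))
      where
      add-sub : ∀ x y → x ≡ x + y - y
      add-sub = solve-∀

-- Induction on the number `d` of columns in between: an adjacent swap moves the right one of the
-- equal columns a step to the left.
det-equalCols< : ∀ {n} d (p q : Fin n) (M : Matrix n) → toℕ q ≡ suc (d ℕ.+ toℕ p) →
  (∀ r → M r p ≡ M r q) → det M ≡ 0ℤ
det-equalCols< zero p (suc i) M e eq
  with refl ← toℕ-injective {i = inject₁ i} {p} (trans (toℕ-inject₁ i) (ℕ.suc-injective e)) =
  det-adjacentEqual i M eq
det-equalCols< {suc n} (suc d) p (suc i) M e eq =
  trans (det-swapAdjacent i M {N} off e₀ e₁)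
    (cong -_ (det-equalCols< d p (inject₁ i) N (trans (toℕ-inject₁ i) (ℕ.suc-injective e))
      (λ r → trans (off r p p≢i p≢s) (trans (eq r) (sym (e₀ r))))))
  where
  N : Matrix (suc n)
  N = setCol (inject₁ i) (λ r → M r (suc i)) (setCol (suc i) (λ r → M r (inject₁ i)) M)
  off : ∀ r c → c ≢ inject₁ i → c ≢ suc i → N r c ≡ M r c
  off r c a b = trans (setCol-off (inject₁ i) _ _ r c a) (setCol-off (suc i) _ _ r c b)
  e₀ : ∀ r → N r (inject₁ i) ≡ M r (suc i)
  e₀ r = setCol-at (inject₁ i) _ _ r
  e₁ : ∀ r → N r (suc i) ≡ M r (inject₁ i)
  e₁ r = trans (setCol-off (inject₁ i) _ _ r (suc i) (inject₁≢suc i ∘ sym)) (setCol-at (suc i) _ _ r)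
  p≢i : p ≢ inject₁ i
  p≢i refl = ℕ.m≢1+n+m (toℕ p) {d} (trans (toℕ-inject₁ i) (ℕ.suc-injective e))
  p≢s : p ≢ suc i
  p≢s refl = ℕ.m≢1+n+m (toℕ p) {suc d} e

det-equalCols : ∀ {n} (p q : Fin n) (M : Matrix n) → p ≢ q → (∀ r → M r p ≡ M r q) → det M ≡ 0ℤ
det-equalCols p q M p≢q eq with ℕ.<-cmp (toℕ p) (toℕ q)
... | tri< p<q _ _ with d , e ← ℕ.m≤n⇒∃[o]m+o≡n p<q =
  det-equalCols< d p q M (sym (trans (cong suc (ℕ.+-comm d (toℕ p))) e)) eq
... | tri≈ _ e _ = ⊥-elim (p≢q (toℕ-injective e))
... | tri> _ _ q<p with d , e ← ℕ.m≤n⇒∃[o]m+o≡n q<p =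
  det-equalCols< d q p M (sym (trans (cong suc (ℕ.+-comm d (toℕ q))) e)) (sym ∘ eq)

module _ {n} (M : Matrix n) (p : Fin n) (f : Fin n → ℤ) (fp : f p ≡ 0ℤ) where
  private
    below : ℕ → Fin n → ℤ
    below m j with toℕ j ℕ.<? m
    ... | yes _ = f j
    ... | no _ = 0ℤ

    below-p : ∀ m → below m p ≡ 0ℤ
    below-p m with toℕ p ℕ.<? m
    ... | yes _ = fp
    ... | no _ = refl

    N : ℕ → Matrix n
    N m i j = M i j + M i p * below m j

    absorb : ∀ a b {c} → c ≡ 0ℤ → a + b * c ≡ a
    absorb a b refl = lem a b
      where
      lem : ∀ a b → a + b * 0ℤ ≡ a
      lem = solve-∀

    below-off : ∀ m j → toℕ j ≢ m → below (suc m) j ≡ below m j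
    below-off m j ne with toℕ j ℕ.<? suc m | toℕ j ℕ.<? m
    ... | yes _ | yes _ = refl
    ... | yes a | no b = ⊥-elim (b (ℕ.≤∧≢⇒< (ℕ.s≤s⁻¹ a) ne))
    ... | no a | yes b = ⊥-elim (a (ℕ.m<n⇒m<1+n b))
    ... | no _ | no _ = refl

    below-new : ∀ j → below (suc (toℕ j)) j ≡ f j
    below-new j with toℕ j ℕ.<? suc (toℕ j)
    ... | yes _ = refl
    ... | no a = ⊥-elim (a (ℕ.n<1+n _))

    below-old : ∀ j → below (toℕ j) j ≡ 0ℤ
    below-old j with toℕ j ℕ.<? toℕ j
    ... | yes a = ⊥-elim (ℕ.<-irrefl refl a)
    ... | no _ = refl

    step : ∀ j → det (N (suc (toℕ j))) ≡ det (N (toℕ j))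
    step j with j ≟ p
    ... | yes refl = det-cong same
      where
      same : ∀ r c → N (suc (toℕ j)) r c ≡ N (toℕ j) r c
      same r c with c ≟ j
      ... | yes refl = cong (λ z → M r j + M r j * z) (trans (below-p (suc (toℕ j))) (sym (below-p (toℕ j))))
      ... | no c≢j = cong (λ z → M r c + M r j * z) (below-off (toℕ j) c (c≢j ∘ toℕ-injective))
    ... | no j≢p =
      trans (det-linear j (f j) {N (suc (toℕ j))} {N (toℕ j)} {E}
              (λ r c c≢j → cong (λ z → M r c + M r p * z) (below-off (toℕ j) c (c≢j ∘ toℕ-injective)))
              (λ r c c≢j → setCol-off j _ (N (toℕ j)) r c c≢j)
              new)
        (absorb _ (f j) (det-equalCols p j E (j≢p ∘ sym)
          (λ r → trans (setCol-off j _ (N (toℕ j)) r p (j≢p ∘ sym))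
            (trans (absorb (M r p) (M r p) (below-p (toℕ j))) (sym (setCol-at j _ (N (toℕ j)) r))))))
      where
      E : Matrix n
      E = setCol j (λ r → M r p) (N (toℕ j))
      new : ∀ r → N (suc (toℕ j)) r j ≡ N (toℕ j) r j + f j * E r j
      new r rewrite below-new j | below-old j | setCol-at j (λ r → M r p) (N (toℕ j)) r =
        lem (M r j) (M r p) (f j)
        where
        lem : ∀ a b c → a + b * c ≡ (a + b * 0ℤ) + c * b
        lem = solve-∀

    upTo : ∀ m → m ℕ.≤ n → det (N m) ≡ det M
    upTo zero _ = det-cong (λ r c → absorb (M r c) (M r p) refl)
    upTo (suc m) m<n = trans
      (subst (λ t → det (N (suc t)) ≡ det (N t)) (toℕ-fromℕ< m<n) (step (fromℕ< m<n)))
      (upTo m (ℕ.<⇒≤ m<n))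

  -- One column at a time: `N m` carries the correction only in columns of index below `m`, and each
  -- step adds a multiple of a determinant with two equal columns. The condition `f p ≡ 0ℤ` keeps
  -- column `p` itself fixed.
  det-addCols : det (λ i j → M i j + M i p * f j) ≡ det M
  det-addCols = trans (det-cong full) (upTo n ℕ.≤-refl)
    where
    full : ∀ i j → M i j + M i p * f j ≡ N n i j
    full i j with toℕ j ℕ.<? n
    ... | yes _ = refl
    ... | no a = ⊥-elim (a (toℕ<n j))

det-firstRow : ∀ {n} (M : Matrix (suc n)) → (∀ j → M zero (suc j) ≡ 0ℤ) →
  det M ≡ M zero zero * det (minor zero M)
det-firstRow M z = trans
  (cong (λ t → M zero zero * det (minor zero M) - t)
    (altSum-zero {f = λ j → M zero (suc j) * det (minor (suc j) M)}
      (λ j → cong (_* det (minor (suc j) M)) (z j))))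
  (ℤ.+-identityʳ _)

-- Multiples of the first two columns clear the first two rows to the right of the leading block.
-- That block has determinant one, so the elimination stays in the integers.
det-schur : ∀ {n} (M : Matrix (suc (suc n))) →
  M zero zero ≡ 0ℤ → M zero (suc zero) ≡ -1ℤ →
  M (suc zero) zero ≡ 1ℤ → M (suc zero) (suc zero) ≡ 0ℤ →
  det M ≡ det (λ i j → M (suc (suc i)) (suc (suc j))
                       - M (suc (suc i)) zero * M (suc zero) (suc (suc j))
                       + M (suc (suc i)) (suc zero) * M zero (suc (suc j)))
det-schur {n} M e₀₀ e₀₁ e₁₀ e₁₁ = begin
  det M
    ≡⟨ det-addCols M zero f refl ⟨
  det N₁
    ≡⟨ det-addCols N₁ (suc zero) g refl ⟨
  det N₂
    ≡⟨⟩
  N₂ zero zero * det (minor zero N₂)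
    - (N₂ zero (suc zero) * det (minor (suc zero) N₂)
       - altSum (λ j → N₂ zero (suc (suc j)) * det (minor (suc (suc j)) N₂)))
    ≡⟨ cong₂ (λ a b → a * det (minor zero N₂) - (b * det (minor (suc zero) N₂)
         - altSum (λ j → N₂ zero (suc (suc j)) * det (minor (suc (suc j)) N₂)))) n₀₀ n₀₁ ⟩
  0ℤ * det (minor zero N₂) - (-1ℤ * det (minor (suc zero) N₂)
       - altSum (λ j → N₂ zero (suc (suc j)) * det (minor (suc (suc j)) N₂)))
    ≡⟨ cong (λ a → 0ℤ * det (minor zero N₂) - (-1ℤ * det (minor (suc zero) N₂) - a))
         (altSum-zero (λ j → cong (_* det (minor (suc (suc j)) N₂)) (n₀ j))) ⟩
  0ℤ * det (minor zero N₂) - (-1ℤ * det (minor (suc zero) N₂) - 0ℤ)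
    ≡⟨ lem₁ (det (minor zero N₂)) (det (minor (suc zero) N₂)) ⟩
  det (minor (suc zero) N₂)
    ≡⟨ det-firstRow (minor (suc zero) N₂) n₁ ⟩
  N₂ (suc zero) zero * det (minor zero (minor (suc zero) N₂))
    ≡⟨ cong (_* det (minor zero (minor (suc zero) N₂))) n₁₀ ⟩
  1ℤ * det (minor zero (minor (suc zero) N₂))
    ≡⟨ ℤ.*-identityˡ _ ⟩
  det (minor zero (minor (suc zero) N₂))
    ≡⟨ det-cong (λ i j → last (M (suc (suc i)) (suc (suc j))) (M (suc (suc i)) zero)
         (M (suc zero) (suc (suc j))) (M (suc (suc i)) (suc zero)) (M zero (suc (suc j)))) ⟩
  _ ∎
  where
  open ≡-Reasoning
  f g : Fin (suc (suc n)) → ℤ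
  f zero = 0ℤ
  f (suc zero) = 0ℤ
  f (suc (suc j)) = - M (suc zero) (suc (suc j))
  g zero = 0ℤ
  g (suc zero) = 0ℤ
  g (suc (suc j)) = M zero (suc (suc j))
  N₁ N₂ : Matrix (suc (suc n))
  N₁ i j = M i j + M i zero * f j
  N₂ i j = N₁ i j + N₁ i (suc zero) * g j
  lem₁ : ∀ a b → 0ℤ * a - (-1ℤ * b - 0ℤ) ≡ b
  lem₁ = solve-∀
  n₀₀ : N₂ zero zero ≡ 0ℤ
  n₀₀ rewrite e₀₀ | e₀₁ = refl
  n₀₁ : N₂ zero (suc zero) ≡ -1ℤ
  n₀₁ rewrite e₀₀ | e₀₁ = refl
  n₁₀ : N₂ (suc zero) zero ≡ 1ℤ
  n₁₀ rewrite e₁₀ | e₁₁ = refl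
  n₀ : ∀ j → N₂ zero (suc (suc j)) ≡ 0ℤ
  n₀ j rewrite e₀₀ | e₀₁ = lem (M zero (suc (suc j))) (M (suc zero) (suc (suc j)))
    where
    lem : ∀ a b → (a + 0ℤ * (- b)) + (-1ℤ + 0ℤ * 0ℤ) * a ≡ 0ℤ
    lem = solve-∀
  n₁ : ∀ j → N₂ (suc zero) (suc (suc j)) ≡ 0ℤ
  n₁ j rewrite e₁₀ | e₁₁ = lem (M (suc zero) (suc (suc j))) (M zero (suc (suc j)))
    where
    lem : ∀ a b → (a + 1ℤ * (- a)) + (0ℤ + 1ℤ * 0ℤ) * b ≡ 0ℤ
    lem = solve-∀
  last : ∀ m a b c d → (m + a * (- b)) + (c + a * 0ℤ) * d ≡ m - a * b + c * d
  last = solve-∀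

prodFin : ∀ {n} → (Fin n → ℤ) → ℤ
prodFin {zero}  d = 1ℤ
prodFin {suc n} d = d zero * prodFin (d ∘ suc)

prodFin-punchIn : ∀ {n} (j : Fin (suc n)) (d : Fin (suc n) → ℤ) →
  d j * prodFin (λ c → d (punchIn j c)) ≡ prodFin d
prodFin-punchIn zero d = refl
prodFin-punchIn {suc n} (suc j) d = trans
  (lem (d (suc j)) (d zero) _)
  (cong (d zero *_) (prodFin-punchIn j (d ∘ suc)))
  where
  lem : ∀ a b c → a * (b * c) ≡ b * (a * c)
  lem = solve-∀

altSum-* : ∀ {n} t (f : Fin n → ℤ) → altSum (λ j → t * f j) ≡ t * altSum f
altSum-* {zero}  t f = sym (ℤ.*-zeroʳ t)
altSum-* {suc n} t f rewrite altSum-* t (f ∘ suc) = lem t (f zero) (altSum (f ∘ suc))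
  where
  lem : ∀ t a b → t * a - t * b ≡ t * (a - b)
  lem = solve-∀

det-scale : ∀ {n} (d e : Fin n → ℤ) (M : Matrix n) →
  det (λ i j → d i * M i j * e j) ≡ (prodFin d * prodFin e) * det M
det-scale {zero}  d e M = refl
det-scale {suc n} d e M = trans (altSum-cong term) (altSum-* (prodFin d * prodFin e) (λ j → M zero j * det (minor j M)))
  where
  lem : ∀ a m b p q x → (a * m * b) * ((p * q) * x) ≡ ((a * p) * (b * q)) * (m * x)
  lem = solve-∀
  term : ∀ j → (d zero * M zero j * e j) * det (minor j (λ r c → d r * M r c * e c)) ≡
    ((d zero * prodFin (d ∘ suc)) * prodFin e) * (M zero j * det (minor j M))
  term j rewrite det-scale (d ∘ suc) (λ c → e (punchIn j c)) (minor j M) =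
    trans (lem (d zero) (M zero j) (e j) (prodFin (d ∘ suc)) _ (det (minor j M)))
      (cong (λ z → ((d zero * prodFin (d ∘ suc)) * z) * (M zero j * det (minor j M))) (prodFin-punchIn j e))

-- Pfaffians of circulant chains

sg : Bool → ℤ
sg true = 1ℤ
sg false = -1ℤ

module _ {V : Set} where

  -- Arbitrary integer forms, because pivoting can lead out of the entries `± 1` of a tournament.
  Form : Set
  Form = V → V → ℤ

  record Skew (ω : Form) : Set where
    field
      diag : ∀ x → ω x x ≡ 0ℤ
      anti : ∀ x y → ω x y ≡ - ω y x
  open Skew

  gram : Form → (xs : List V) → Matrix (length xs)
  gram ω xs i j = ω (lookup xs i) (lookup xs j)

  -- The Schur complement of `ω` with respect to `a` and `b`, in the normalisation `ω a b ≡ -1ℤ`.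
  pivot : Form → V → V → Form
  pivot ω a b x y = ω x y - ω x a * ω b y + ω x b * ω a y

  pivot-skew : ∀ {ω} a b → Skew ω → Skew (pivot ω a b)
  pivot-skew {ω} a b sk .diag x
    rewrite diag sk x | anti sk b x | anti sk a x = lem (ω x a) (ω x b)
    where
    lem : ∀ p q → 0ℤ - p * (- q) + q * (- p) ≡ 0ℤ
    lem = solve-∀
  pivot-skew {ω} a b sk .anti x y
    rewrite anti sk x y | anti sk b y | anti sk a y | anti sk b x | anti sk a x =
    lem (ω y x) (ω x a) (ω x b) (ω y a) (ω y b)
    where
    lem : ∀ w p q r s → - w - p * (- s) + q * (- r) ≡ - (w - r * (- q) + s * (- p))
    lem = solve-∀

  det-gram-pivot : ∀ {ω} → Skew ω → ∀ a b cs → ω a b ≡ -1ℤ →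
    det (gram ω (a ∷ b ∷ cs)) ≡ det (gram (pivot ω a b) cs)
  det-gram-pivot {ω} sk a b cs e = det-schur (gram ω (a ∷ b ∷ cs))
    (diag sk a) e (trans (anti sk b a) (cong -_ e)) (diag sk b)

  data AltFrom (f : V → ℤ) : Bool → List V → Set where
    []  : ∀ {s} → AltFrom f s []
    _∷_ : ∀ {s p ps} → f p ≡ sg s → AltFrom f (not s) ps → AltFrom f s (p ∷ ps)

  -- Circ ω (c₀ ∷ c₁ ∷ …): ω cᵢ cⱼ = (-1)^(j - i) for i < j.
  data Circ (ω : Form) : List V → Set where
    []  : Circ ω []
    _∷_ : ∀ {p ps} → AltFrom (ω p) false ps → Circ ω ps → Circ ω (p ∷ ps)

  data EvenL : List V → Set where
    []  : EvenL []
    pair : ∀ {a b ps} → EvenL ps → EvenL (a ∷ b ∷ ps)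

  total : (V → ℤ) → List V → ℤ
  total f [] = 0ℤ
  total f (p ∷ ps) = f p + total f ps

  -- Q f g [p₀, p₁, …] = Σ_{i<j} (f pᵢ · g pⱼ − f pⱼ · g pᵢ)
  Q : (f g : V → ℤ) → List V → ℤ
  Q f g [] = 0ℤ
  Q f g (p ∷ ps) = f p * total g ps - g p * total f ps + Q f g ps

  total-cong : ∀ {f g} ps → (∀ p → p ∈ ps → f p ≡ g p) → total f ps ≡ total g ps
  total-cong [] e = refl
  total-cong (p ∷ ps) e = cong₂ _+_ (e p (here refl)) (total-cong ps (λ r m → e r (there m)))

  Q-cong : ∀ {f f′ g g′} ps → (∀ p → p ∈ ps → f p ≡ f′ p) → (∀ p → p ∈ ps → g p ≡ g′ p) →
    Q f g ps ≡ Q f′ g′ ps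
  Q-cong [] e d = refl
  Q-cong {f} {f′} {g} {g′} (p ∷ ps) e d
    rewrite e p (here refl) | d p (here refl)
          | total-cong {f} {f′} ps (λ r m → e r (there m))
          | total-cong {g} {g′} ps (λ r m → d r (there m))
          | Q-cong {f} {f′} {g} {g′} ps (λ r m → e r (there m)) (λ r m → d r (there m)) = refl

  total-linear : ∀ f t h ps → total (λ p → f p + t * h p) ps ≡ total f ps + t * total h ps
  total-linear f t h [] = sym (trans (ℤ.+-identityˡ _) (ℤ.*-zeroʳ t))
  total-linear f t h (p ∷ ps) rewrite total-linear f t h ps =
    lem (f p) t (h p) (total f ps) (total h ps)
    where
    lem : ∀ a t b c d → (a + t * b) + (c + t * d) ≡ (a + c) + t * (b + d)
    lem = solve-∀

  Q-linearʳ : ∀ f g t h ps → Q f (λ p → g p + t * h p) ps ≡ Q f g ps + t * Q f h ps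
  Q-linearʳ f g t h [] = sym (trans (ℤ.+-identityˡ _) (ℤ.*-zeroʳ t))
  Q-linearʳ f g t h (p ∷ ps) rewrite total-linear g t h ps | Q-linearʳ f g t h ps =
    lem (f p) (g p) (h p) t (total f ps) (total g ps) (total h ps) (Q f g ps) (Q f h ps)
    where
    lem : ∀ f g h t F G H x y → f * (G + t * H) - (g + t * h) * F + (x + t * y) ≡
      (f * G - g * F + x) + t * (f * H - h * F + y)
    lem = solve-∀

  total-alternating : ∀ {z s ps} → EvenL ps → AltFrom z s ps → total z ps ≡ 0ℤ
  total-alternating [] [] = refl
  total-alternating {s = true} (pair ev) (e ∷ (d ∷ al)) rewrite e | d | total-alternating ev al = refl
  total-alternating {s = false} (pair ev) (e ∷ (d ∷ al)) rewrite e | d | total-alternating ev al = refl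

  -- Along an even list an alternating z satisfies Q z g = total g, and Q z z = 0.
  Q-shift : ∀ {z ps} f g α β → EvenL ps → AltFrom z true ps →
    Q (λ p → f p + α * z p) (λ p → g p + β * z p) ps ≡ Q f g ps + α * total g ps - β * total f ps
  Q-shift f g α β [] [] = lem α β
    where
    lem : ∀ α β → 0ℤ ≡ 0ℤ + α * 0ℤ - β * 0ℤ
    lem = solve-∀
  Q-shift {z} {a ∷ b ∷ ps} f g α β (pair ev) (e ∷ (d ∷ al))
    rewrite e | d | total-linear f α z ps | total-linear g β z ps | total-alternating ev al
          | Q-shift f g α β ev al =
    lem α β (f a) (f b) (g a) (g b) (total f ps) (total g ps) (Q f g ps)
    where
    lem : ∀ α β fa fb ga gb F G q →
      (fa + α * 1ℤ) * ((gb + β * -1ℤ) + (G + β * 0ℤ)) - (ga + β * 1ℤ) * ((fb + α * -1ℤ) + (F + α * 0ℤ))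
        + ((fb + α * -1ℤ) * (G + β * 0ℤ) - (gb + β * -1ℤ) * (F + α * 0ℤ) + (q + α * G - β * F))
      ≡ (fa * (gb + G) - ga * (fb + F) + (fb * G - gb * F + q)) + α * (ga + (gb + G)) - β * (fa + (fb + F))
    lem = solve-∀

  alternating-opposite : ∀ {f g s ps} → AltFrom f (not s) ps → AltFrom g s ps →
    ∀ p → p ∈ ps → f p ≡ - g p
  alternating-opposite {s = true} (e ∷ al) (d ∷ bl) p (here refl) rewrite e | d = refl
  alternating-opposite {s = false} (e ∷ al) (d ∷ bl) p (here refl) rewrite e | d = refl
  alternating-opposite (e ∷ al) (d ∷ bl) p (there m) = alternating-opposite al bl p m

  AltFrom-cong : ∀ {f g s ps} → (∀ p → p ∈ ps → g p ≡ f p) → AltFrom f s ps → AltFrom g s ps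
  AltFrom-cong e [] = []
  AltFrom-cong e (d ∷ al) = trans (e _ (here refl)) d ∷ AltFrom-cong (λ p m → e p (there m)) al

  AltFrom-neg : ∀ {f g s ps} → (∀ p → g p ≡ - f p) → AltFrom f s ps → AltFrom g (not s) ps
  AltFrom-neg n [] = []
  AltFrom-neg {s = true} n (d ∷ al) = trans (n _) (cong -_ d) ∷ AltFrom-neg n al
  AltFrom-neg {s = false} n (d ∷ al) = trans (n _) (cong -_ d) ∷ AltFrom-neg n al

  Circ-cong : ∀ {ω ω′ ps} → (∀ p r → p ∈ ps → r ∈ ps → ω′ p r ≡ ω p r) → Circ ω ps → Circ ω′ ps
  Circ-cong e [] = []
  Circ-cong e (al ∷ c) =
    AltFrom-cong (λ r m → e _ r (here refl) (there m)) al ∷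
    Circ-cong (λ p r m n → e p r (there m) (there n)) c

  det₂ : ∀ (M : Matrix 2) → det M ≡ M zero zero * M (suc zero) (suc zero) - M zero (suc zero) * M (suc zero) zero
  det₂ M = lem (M zero zero) (M zero (suc zero)) (M (suc zero) zero) (M (suc zero) (suc zero))
    where
    lem : ∀ a b c d → a * (d * 1ℤ - 0ℤ) - (b * (c * 1ℤ - 0ℤ) - 0ℤ) ≡ a * d - b * c
    lem = solve-∀

  pf : Form → List V → V → V → ℤ
  pf ω ps u v = ω u v + Q (λ p → ω p u) (λ p → ω p v) ps

  -- pf is, up to sign, the Pfaffian: pivoting on the first two elements of ps does not change it.
  det-chain : ∀ {ω ps} u v → Skew ω → EvenL ps → Circ ω ps →
    det (gram ω (ps ++ u ∷ v ∷ [])) ≡ pf ω ps u v * pf ω ps u v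
  det-chain {ω} u v sk [] [] = trans (det₂ (gram ω (u ∷ v ∷ []))) (lem₁ (diag sk u) (anti sk v u))
    where
    lem₁ : ω u u ≡ 0ℤ → ω v u ≡ - ω u v → ω u u * ω v v - ω u v * ω v u ≡ pf ω [] u v * pf ω [] u v
    lem₁ e d rewrite e | d = lem (ω v v) (ω u v)
      where
      lem : ∀ a b → 0ℤ * a - b * (- b) ≡ (b + 0ℤ) * (b + 0ℤ)
      lem = solve-∀
  det-chain {ω} {a ∷ b ∷ ps} u v sk (pair ev) ((ab ∷ alA) ∷ (alB ∷ c)) =
    trans (det-gram-pivot sk a b (ps ++ u ∷ v ∷ []) ab)
      (trans (det-chain u v (pivot-skew a b sk) ev (Circ-cong same c))
        (cong (λ t → t * t) pf-pivot))
    where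
    -- Two consecutive vertices of the circle have opposite entries at everything later, so the two
    -- correction terms of the pivot cancel inside `ps` and the form stays circulant there.
    opp : ∀ p → p ∈ ps → ω a p ≡ - ω b p
    opp = alternating-opposite alA alB
    opp′ : ∀ p → p ∈ ps → ω p a ≡ - ω p b
    opp′ p m = trans (anti sk p a) (trans (cong -_ (opp p m)) (cong -_ (sym (anti sk p b))))
    same : ∀ p r → p ∈ ps → r ∈ ps → pivot ω a b p r ≡ ω p r
    same p r m n rewrite opp r n | opp′ p m = lem (ω p r) (ω p b) (ω b r)
      where
      lem : ∀ x y z → x - (- y) * z + y * (- z) ≡ x
      lem = solve-∀
    -- The column of an outside vertex changes by a multiple of the alternating vector `ω p b`,
    -- which is the change that `Q-shift` evaluates.
    column : ∀ w p → p ∈ ps → pivot ω a b p w ≡ ω p w + (ω a w + ω b w) * ω p b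
    column w p m rewrite opp′ p m = lem (ω p w) (ω p b) (ω b w) (ω a w)
      where
      lem : ∀ x y z t → x - (- y) * z + y * t ≡ x + (t + z) * y
      lem = solve-∀
    pf-pivot : pf (pivot ω a b) ps u v ≡ pf ω (a ∷ b ∷ ps) u v
    pf-pivot = trans
      (cong (λ t → pivot ω a b u v + t) (trans (Q-cong ps (column u) (column v))
        (Q-shift (λ p → ω p u) (λ p → ω p v) (ω a u + ω b u) (ω a v + ω b v) ev (AltFrom-neg (λ p → anti sk p b) alB))))
      (fin (anti sk u a) (anti sk u b))
      where
      U W q : ℤ
      U = total (λ p → ω p u) ps
      W = total (λ p → ω p v) ps
      q = Q (λ p → ω p u) (λ p → ω p v) ps
      lem : ∀ c ua va ub vb U W q →
        (c - (- ua) * vb + (- ub) * va) + (q + (ua + ub) * W - (va + vb) * U) ≡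
        c + (ua * (vb + W) - va * (ub + U) + (ub * W - vb * U + q))
      lem = solve-∀
      fin : ω u a ≡ - ω a u → ω u b ≡ - ω b u →
        (ω u v - ω u a * ω b v + ω u b * ω a v) + (q + (ω a u + ω b u) * W - (ω a v + ω b v) * U) ≡
        pf ω (a ∷ b ∷ ps) u v
      fin e d rewrite e | d = lem (ω u v) (ω a u) (ω a v) (ω b u) (ω b v) U W q

-- Cyclic words

Within : ℤ → ℤ → Set
Within K x = - K ≤ x × x ≤ K

-- Two values in `[-K, K]` differ by at most `2K`; `d` is the surplus of the computed difference.
excess : ∀ {K x y} d → Within K x → Within K y → x - y ≡ (K + K) + d → d ≤ 0ℤ
excess {K} {x} {y} d (_ , x≤K) (-K≤y , _) e =
  subst (_≤ 0ℤ) (trans (cong (λ t → t - (K - (- K))) e) (lem K d))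
    (ℤ.i≤j⇒i-j≤0 (ℤ.+-mono-≤ x≤K (ℤ.neg-mono-≤ -K≤y)))
  where
  lem : ∀ K d → ((K + K) + d) - (K - (- K)) ≡ d
  lem = solve-∀

double≢1 : ∀ m → m + m ≢ 1ℤ
double≢1 (+ zero) ()
double≢1 (+ suc n) e with () ← trans (sym (ℕ.+-suc n n)) (ℕ.suc-injective (ℤ.+-injective e))

sm : List Bool → ℤ
sm [] = 0ℤ
sm (a ∷ w) = sg a + sm w

len : List Bool → ℤ
len [] = 0ℤ
len (a ∷ w) = 1ℤ + len w

-- A [b₀, b₁, …] = Σ_{i<j} (bⱼ − bᵢ)
A : List Bool → ℤ
A [] = 0ℤ
A (a ∷ w) = sm w - len w * sg a + A w

sm-++ : ∀ v w → sm (v ++ w) ≡ sm v + sm w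
sm-++ [] w = sym (ℤ.+-identityˡ _)
sm-++ (a ∷ v) w rewrite sm-++ v w = sym (ℤ.+-assoc (sg a) (sm v) (sm w))

len-length : ∀ w → len w ≡ + length w
len-length [] = refl
len-length (a ∷ w) = cong (λ t → 1ℤ + t) (len-length w)

len-++ : ∀ v w → len (v ++ w) ≡ len v + len w
len-++ [] w = sym (ℤ.+-identityˡ _)
len-++ (a ∷ v) w = trans (cong (λ t → 1ℤ + t) (len-++ v w)) (sym (ℤ.+-assoc 1ℤ (len v) (len w)))

-- The cross terms are antisymmetric in `v` and `w`, so they govern how `A` changes when the cyclic
-- word is cut elsewhere.
A-++ : ∀ v w → A (v ++ w) ≡ A v + A w + len v * sm w - len w * sm v
A-++ [] w = lem (A w) (sm w) (len w)
  where
  lem : ∀ a b c → a ≡ 0ℤ + a + 0ℤ * b - c * 0ℤ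
  lem = solve-∀
A-++ (a ∷ v) w = trans
  (cong₂ _+_ (cong₂ (λ σ l → σ - l * sg a) (sm-++ v w) (len-++ v w)) (A-++ v w))
  (lem (sg a) (sm v) (sm w) (len v) (len w) (A v) (A w))
  where
  lem : ∀ a σ τ l m x y → (σ + τ) - (l + m) * a + (x + y + l * τ - m * σ) ≡
    (σ - l * a + x) + y + (1ℤ + l) * τ - m * (a + σ)
  lem = solve-∀

sm-parity : ∀ w → ∃ λ t → sm w + len w ≡ t + t
sm-parity [] = 0ℤ , refl
sm-parity (true ∷ w) with t , e ← sm-parity w =
  1ℤ + t , trans (l₁ (sm w) (len w)) (trans (cong (λ z → 1ℤ + 1ℤ + z) e) (l₂ t))
  where
  l₁ : ∀ a b → (1ℤ + a) + (1ℤ + b) ≡ 1ℤ + 1ℤ + (a + b)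
  l₁ = solve-∀
  l₂ : ∀ t → 1ℤ + 1ℤ + (t + t) ≡ (1ℤ + t) + (1ℤ + t)
  l₂ = solve-∀
sm-parity (false ∷ w) with t , e ← sm-parity w = t , trans (l₁ (sm w) (len w)) e
  where
  l₁ : ∀ a b → (-1ℤ + a) + (1ℤ + b) ≡ a + b
  l₁ = solve-∀

sm-odd : ∀ {w} j → length w ≡ suc (j ℕ.+ j) → ∀ m → sm w ≢ m + m
sm-odd {w} j l m e with t , d ← sm-parity w =
  double≢1 (t - m - + j) (trans (l₁ t m (+ j)) (trans (cong (λ z → z - (m + m) - (+ j + + j)) eq) (l₂ m (+ j))))
  where
  eq : t + t ≡ (m + m) + (1ℤ + (+ j + + j))
  eq = trans (sym d) (cong₂ _+_ e (trans (len-length w) (cong +_ l)))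
  l₁ : ∀ t m j → (t - m - j) + (t - m - j) ≡ (t + t) - (m + m) - (j + j)
  l₁ = solve-∀
  l₂ : ∀ m j → (m + m) + (1ℤ + (j + j)) - (m + m) - (j + j) ≡ 1ℤ
  l₂ = solve-∀

-- Concatenations of n blocks -++ and any number of blocks -+.
data Blocks : ℕ → List Bool → Set where
  []  : Blocks 0 []
  mp  : ∀ {n w} → Blocks n w → Blocks n (false ∷ true ∷ w)
  mpp : ∀ {n w} → Blocks n w → Blocks (suc n) (false ∷ true ∷ true ∷ w)

Blocks-sum : ∀ {n w} → Blocks n w → sm w ≡ + n
Blocks-sum [] = refl
Blocks-sum (mp b) rewrite Blocks-sum b = refl
Blocks-sum (mpp b) rewrite Blocks-sum b = refl

Blocks-++ : ∀ {m n v w} → Blocks m v → Blocks n w → Blocks (m ℕ.+ n) (v ++ w)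
Blocks-++ [] b = b
Blocks-++ (mp a) b = mp (Blocks-++ a b)
Blocks-++ (mpp a) b = mpp (Blocks-++ a b)

Blocks-split : ∀ {n w} → Blocks (suc n) w →
  ∃ λ v → ∃ λ r → w ≡ v ++ false ∷ true ∷ true ∷ r × Blocks 0 v × Blocks n r
Blocks-split (mp b) with v , r , refl , p , q ← Blocks-split b =
  false ∷ true ∷ v , r , refl , mp p , q
Blocks-split (mpp b) = [] , _ , refl , [] , b

Blocks-last : ∀ {n w} → Blocks n w → w ≡ [] ⊎ ∃ λ v → w ≡ false ∷ v ++ true ∷ []
Blocks-last [] = inj₁ refl
Blocks-last (mp b) with Blocks-last b
... | inj₁ refl = inj₂ ([] , refl)
... | inj₂ (v , refl) = inj₂ (true ∷ false ∷ v , refl)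
Blocks-last (mpp b) with Blocks-last b
... | inj₁ refl = inj₂ (true ∷ [] , refl)
... | inj₂ (v , refl) = inj₂ (true ∷ true ∷ false ∷ v , refl)

-- A block `-++` makes the second and the last letter different occurrences of `+`; the pattern in
-- `pmppmp` needs both.
Blocks-ends : ∀ {n w} → Blocks (suc n) w → ∃ λ v → w ≡ false ∷ true ∷ v ++ true ∷ []
Blocks-ends (mp b) with Blocks-last b
Blocks-ends (mp ()) | inj₁ refl
... | inj₂ (v , refl) = false ∷ v , refl
Blocks-ends (mpp b) with Blocks-last b
... | inj₁ refl = [] , refl
... | inj₂ (v , refl) = true ∷ false ∷ v , refl

Blocks₀-alternating : ∀ {w} → Blocks 0 w → AltFrom sg false (w ++ false ∷ true ∷ [])
Blocks₀-alternating [] = refl ∷ refl ∷ []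
Blocks₀-alternating (mp b) = refl ∷ refl ∷ Blocks₀-alternating b

allOrSplit : ∀ w → All (_≡ true) w ⊎ ∃ λ u → ∃ λ v → w ≡ u ++ false ∷ v
allOrSplit [] = inj₁ []
allOrSplit (false ∷ w) = inj₂ ([] , w , refl)
allOrSplit (true ∷ w) with allOrSplit w
... | inj₁ a = inj₁ (refl ∷ a)
... | inj₂ (u , v , refl) = inj₂ (true ∷ u , v , refl)

-- P holds for the rotations of a cyclic ±1 word of odd length.  The assumptions del₁ and del₂ bound
-- the Pfaffians c − A e; comparing two cuts of the same cyclic word forces its shape.
module CyclicWord (j : ℕ) (c s : ℤ) (P : List Bool → Set)
  (rot₁ : ∀ {a w} → P (a ∷ w) → P (w ++ a ∷ []))
  (size : ∀ {w} → P w → length w ≡ suc (j ℕ.+ j))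
  (sum  : ∀ {w} → P w → sm w ≡ s)
  (del₁ : ∀ {a e} → P (a ∷ e) → Within (+ suc (j ℕ.+ j)) (c - A e))
  (del₂ : ∀ {a x y} e₁ {e₂} → P (a ∷ e₁ ++ x ∷ y ∷ e₂) → Within (+ suc (j ℕ.+ j)) (c - A (e₁ ++ e₂)))
  (s>0  : 0ℤ < s)
  where

  K : ℤ
  K = + suc (j ℕ.+ j)

  rot : ∀ v {w} → P (v ++ w) → P (w ++ v)
  rot [] {w} p = subst P (sym (++-identityʳ w)) p
  rot (a ∷ v) {w} p = subst P (++-assoc w (a ∷ []) v)
    (rot v (subst P (++-assoc v w (a ∷ [])) (rot₁ p)))

  lenK : ∀ {w} → P w → len w ≡ K
  lenK {w} p = trans (len-length w) (cong +_ (size p))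

  s≰0 : s ≤ 0ℤ → ⊥
  s≰0 q = ℤ.<⇒≱ s>0 q

  -- Deleting one or the other of the two minus signs gives values that differ by `2K + 2s`.
  no-mm : ∀ {w} → P (false ∷ false ∷ w) → ⊥
  no-mm {w} p = ℤ.<⇒≱ (ℤ.+-mono-< s>0 s>0)
    (excess (s + s) (del₁ (rot₁ p)) (del₁ p) eq)
    where
    lem : ∀ c σ l a → (c - (a + 0ℤ + l * -1ℤ - 1ℤ * σ)) - (c - (σ - l * -1ℤ + a)) ≡
      ((1ℤ + (1ℤ + l)) + (1ℤ + (1ℤ + l))) + ((-1ℤ + (-1ℤ + σ)) + (-1ℤ + (-1ℤ + σ)))
    lem = solve-∀
    eq : (c - A (w ++ false ∷ [])) - (c - A (false ∷ w)) ≡ (K + K) + (s + s)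
    eq = trans (cong (λ z → (c - z) - (c - A (false ∷ w))) (A-++ w (false ∷ [])))
      (trans (lem c (sm w) (len w) (A w)) (cong₂ (λ K s → (K + K) + (s + s)) (lenK p) (sum p)))

  -- Deleting the plus sign before or after the minus gives values that differ by `4s`, whence
  -- `2s ≤ K`.
  pmp : ∀ {w} → P (true ∷ false ∷ true ∷ w) → + 4 * s - + 2 * K ≤ 0ℤ
  pmp {w} p = excess _ (del₁ (rot (true ∷ false ∷ []) p)) (del₁ p) eq
    where
    lem : ∀ c σ l a → (c - (a + -[1+ 1 ] + l * 0ℤ - + 2 * σ)) -
        (c - ((1ℤ + σ) - (1ℤ + l) * -1ℤ + (σ - l * 1ℤ + a))) ≡
      ((1ℤ + (1ℤ + (1ℤ + l))) + (1ℤ + (1ℤ + (1ℤ + l)))) +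
        (+ 4 * (1ℤ + (-1ℤ + (1ℤ + σ))) - + 2 * (1ℤ + (1ℤ + (1ℤ + l))))
    lem = solve-∀
    eq : (c - A (w ++ true ∷ false ∷ [])) - (c - A (false ∷ true ∷ w)) ≡ (K + K) + (+ 4 * s - + 2 * K)
    eq = trans (cong (λ z → (c - z) - (c - A (false ∷ true ∷ w))) (A-++ w (true ∷ false ∷ [])))
      (trans (lem c (sm w) (len w) (A w)) (cong₂ (λ K s → (K + K) + (+ 4 * s - + 2 * K)) (lenK p) (sum p)))

  -- Deleting the first or the third plus sign gives values that differ by `4K - 4s`, whence
  -- `K ≤ 2s`.
  ppp : ∀ {w} → P (true ∷ true ∷ true ∷ w) → + 2 * K - + 4 * s ≤ 0ℤ
  ppp {w} p = excess _ (del₁ p) (del₁ (rot (true ∷ true ∷ []) p)) eq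
    where
    lem : ∀ c σ l a → (c - ((1ℤ + σ) - (1ℤ + l) * 1ℤ + (σ - l * 1ℤ + a))) -
        (c - (a + 0ℤ + l * + 2 - + 2 * σ)) ≡
      ((1ℤ + (1ℤ + (1ℤ + l))) + (1ℤ + (1ℤ + (1ℤ + l)))) +
        (+ 2 * (1ℤ + (1ℤ + (1ℤ + l))) - + 4 * (1ℤ + (1ℤ + (1ℤ + σ))))
    lem = solve-∀
    eq : (c - A (true ∷ true ∷ w)) - (c - A (w ++ true ∷ true ∷ [])) ≡ (K + K) + (+ 2 * K - + 4 * s)
    eq = trans (cong (λ z → (c - A (true ∷ true ∷ w)) - (c - z)) (A-++ w (true ∷ true ∷ [])))
      (trans (lem c (sm w) (len w) (A w)) (cong₂ (λ K s → (K + K) + (+ 2 * K - + 4 * s)) (lenK p) (sum p)))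

  -- Here the inner ++ is deleted: both remaining minus signs become adjacent.
  pmppmp : ∀ {w} → P (true ∷ false ∷ true ∷ true ∷ false ∷ true ∷ w) → + 6 * s - + 16 ≤ 0ℤ
  pmppmp {w} p = excess _ (subst (λ z → Within K (c - A z)) (++-assoc w _ _) cut₂) (del₂ (false ∷ []) p) eq
    where
    cut₂ : Within K (c - A ((w ++ true ∷ false ∷ []) ++ false ∷ []))
    cut₂ = del₂ (w ++ true ∷ false ∷ []) (subst (λ z → P (true ∷ z)) (sym (++-assoc w _ _))
      (rot (true ∷ false ∷ true ∷ true ∷ false ∷ []) p))
    lem : ∀ c σ l a → (c - (a + -[1+ 3 ] + l * -1ℤ - + 3 * σ)) -
        (c - ((-1ℤ + (1ℤ + σ)) - (1ℤ + (1ℤ + l)) * -1ℤ + ((1ℤ + σ) - (1ℤ + l) * -1ℤ + (σ - l * 1ℤ + a)))) ≡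
      ((1ℤ + (1ℤ + (1ℤ + (1ℤ + (1ℤ + (1ℤ + l)))))) + (1ℤ + (1ℤ + (1ℤ + (1ℤ + (1ℤ + (1ℤ + l))))))) + (+ 6 * (1ℤ + (-1ℤ + (1ℤ + (1ℤ + (-1ℤ + (1ℤ + σ)))))) - + 16)
    lem = solve-∀
    eq : (c - A (w ++ true ∷ false ∷ false ∷ [])) - (c - A (false ∷ false ∷ true ∷ w)) ≡
      (K + K) + (+ 6 * s - + 16)
    eq = trans (cong (λ z → (c - z) - (c - A (false ∷ false ∷ true ∷ w))) (A-++ w (true ∷ false ∷ false ∷ [])))
      (trans (lem c (sm w) (len w) (A w)) (cong₂ (λ K s → (K + K) + (+ 6 * s - + 16)) (lenK p) (sum p)))

  s-odd : ∀ {w} → P w → ∀ m → s ≢ m + m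
  s-odd {w} p m e = sm-odd {w} j (size p) m (trans (sum p) e)

  mp-start : ∀ {w} → P (false ∷ w) → + 4 * s - + 2 * K ≤ 0ℤ
  mp-start {[]} p = ⊥-elim (s≰0 (subst (_≤ 0ℤ) (sum p) -≤+))
  mp-start {false ∷ w} p = ⊥-elim (no-mm p)
  mp-start {true ∷ w} p with initLast w
  ... | [] = ⊥-elim (s≰0 (subst (_≤ 0ℤ) (sum p) (+≤+ ℕ.z≤n)))
  ... | v ∷ʳ′ false = ⊥-elim (no-mm (rot (false ∷ true ∷ v) p))
  ... | v ∷ʳ′ true = pmp (rot (false ∷ true ∷ v) p)

  module _ (4s≤2K : + 4 * s - + 2 * K ≤ 0ℤ) where

    -- Together with the opposite inequality from an isolated minus, three plus signs in a row would
    -- force `2s = K`, but `K` is odd.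
    no-ppp : ∀ {w} → P (true ∷ true ∷ true ∷ w) → ⊥
    no-ppp p = double≢1 (s - + j) (ℤ.*-cancelˡ-≡ (+ 2) _ _
        (trans (l₁ s (+ j)) (trans (cong (_- + 4 * + j) 4s≡2K) (l₂ (+ j)))))
      where
      geq : 0ℤ ≤ + 4 * s - + 2 * K
      geq = subst (0ℤ ≤_) (l (+ 4 * s) (+ 2 * K)) (ℤ.neg-mono-≤ (ppp p))
        where
        l : ∀ a b → - (b - a) ≡ a - b
        l = solve-∀
      4s≡2K : + 4 * s ≡ + 2 * K
      4s≡2K = ℤ.i-j≡0⇒i≡j (+ 4 * s) (+ 2 * K) (ℤ.≤-antisym 4s≤2K geq)
      l₁ : ∀ s j → + 2 * ((s - j) + (s - j)) ≡ + 4 * s - + 4 * j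
      l₁ = solve-∀
      l₂ : ∀ j → + 2 * (1ℤ + (j + j)) - + 4 * j ≡ + 2 * 1ℤ
      l₂ = solve-∀

    startsMinus : ∀ u {v} → u ≡ [] ⊎ (∃ λ u′ → u ≡ false ∷ u′) →
      u ++ false ∷ v ≡ [] ⊎ (∃ λ u′ → u ++ false ∷ v ≡ false ∷ u′)
    startsMinus u (inj₁ refl) = inj₂ (_ , refl)
    startsMinus u (inj₂ (_ , refl)) = inj₂ (_ , refl)

    -- `u` is the part of the cyclic word already read. It is either empty or begins with a minus,
    -- so that a minus at the very end meets another one across the cut.
    parse : ∀ u v → P (u ++ false ∷ v) → u ≡ [] ⊎ (∃ λ u′ → u ≡ false ∷ u′) → ∃ λ n → Blocks n (false ∷ v)
    parse u [] p (inj₁ refl) = ⊥-elim (s≰0 (subst (_≤ 0ℤ) (sum p) -≤+))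
    parse u [] p (inj₂ (u′ , refl)) = ⊥-elim (no-mm (rot u p))
    parse u (false ∷ v) p st = ⊥-elim (no-mm (rot u p))
    parse u (true ∷ []) p st = _ , mp []
    parse u (true ∷ false ∷ v) p st
      with n , b ← parse (u ++ false ∷ true ∷ []) v (subst P (sym (++-assoc u _ _)) p) (startsMinus u st)
      = n , mp b
    parse u (true ∷ true ∷ []) p st = _ , mpp []
    parse u (true ∷ true ∷ false ∷ v) p st
      with n , b ← parse (u ++ false ∷ true ∷ true ∷ []) v (subst P (sym (++-assoc u _ _)) p) (startsMinus u st)
      = suc n , mpp b
    parse u (true ∷ true ∷ true ∷ v) p st =
      ⊥-elim (no-ppp (rot (u ++ false ∷ []) (subst P (sym (++-assoc u _ _)) p)))

  -- The sum `s` counts the blocks `-++`, so there is at least one. If there is exactly one, cutting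
  -- between its two plus signs leaves an alternating word that begins and ends with `+`.
  fromBlocks : ∀ {n w} → Blocks n w → P w → ∃ λ w → P w × AltFrom sg true w
  fromBlocks {zero} b p = ⊥-elim (s≰0 (subst (_≤ 0ℤ) (trans (sym (Blocks-sum b)) (sum p)) (+≤+ ℕ.z≤n)))
  fromBlocks {suc n} b p with v , r , refl , bv , br ← Blocks-split b
    with n
  ... | zero = _ , rot (false ∷ true ∷ []) (rot v p) ,
      refl ∷ subst (AltFrom sg false) (sym (++-assoc r v _)) alt
    where
    alt : AltFrom sg false (r ++ v ++ false ∷ true ∷ [])
    alt = subst (AltFrom sg false) (++-assoc r v _) (Blocks₀-alternating (Blocks-++ br bv))
  ... | suc m with x , e ← Blocks-ends (Blocks-++ br bv) = ⊥-elim (absurd m (sym (trans (sym (sum p)) (Blocks-sum b))))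
    where
    q : P (false ∷ true ∷ true ∷ r ++ v)
    q = rot v p
    bound : + 6 * s - + 16 ≤ 0ℤ
    bound = pmppmp (rot (false ∷ true ∷ true ∷ false ∷ true ∷ x) (subst (λ z → P (false ∷ true ∷ true ∷ z)) e q))
    -- With two or more blocks `-++`: `s = 2` fails by parity, and `s ≥ 3` contradicts `6s ≤ 16`.
    absurd : ∀ m → + suc (suc m) ≡ s → ⊥
    absurd zero e = s-odd p 1ℤ (sym e)
    absurd (suc m) e = ℤ.<⇒≱ pos bound
      where
      pos : 0ℤ < + 6 * s - + 16
      pos = subst (λ z → 0ℤ < + 6 * z - + 16) e (subst (0ℤ <_) (sym (trans (lem (+ m)) (cong (λ t → + 2 + t) (sym (ℤ.pos-* 6 m))))) (+<+ (ℕ.s≤s ℕ.z≤n)))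
        where
        lem : ∀ m → + 6 * (+ 3 + m) - + 16 ≡ + 2 + + 6 * m
        lem = solve-∀

  shape : ∀ {w} → P w → ∃ λ w → P w × (All (_≡ true) w ⊎ AltFrom sg true w)
  shape {w} p with allOrSplit w
  ... | inj₁ a = w , p , inj₁ a
  ... | inj₂ (u , v , refl) with n , b ← parse (mp-start (rot u p)) [] (v ++ u) (rot u p) (inj₁ refl)
    with x , px , al ← fromBlocks b (rot u p) = x , px , inj₂ al

-- Alternating lists and circulant forms

open Skew

sg-not : ∀ s → sg (not s) ≡ - sg s
sg-not true = refl
sg-not false = refl

sg≢0 : ∀ s → sg s ≢ 0ℤ
sg≢0 true ()
sg≢0 false ()

module _ {V : Set} where

  Q-alternating : ∀ {z : V → ℤ} {s ps} f → EvenL ps → AltFrom z s ps →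
    Q f z ps ≡ - (sg s * total f ps)
  Q-alternating {s = s} f [] [] = sym (cong -_ (ℤ.*-zeroʳ (sg s)))
  Q-alternating {z} {s} {a ∷ b ∷ ps} f (pair ev) (e ∷ (d ∷ al))
    rewrite e | d | not-involutive s | total-alternating ev al | Q-alternating f ev al | sg-not s =
    lem (sg s) (f a) (f b) (total f ps)
    where
    lem : ∀ s a b F → a * (- s + 0ℤ) - s * (b + F) + (b * 0ℤ - - s * F + - (s * F)) ≡ - (s * (a + (b + F)))
    lem = solve-∀

  Q-anti : ∀ f g (ps : List V) → Q f g ps ≡ - Q g f ps
  Q-anti f g [] = refl
  Q-anti f g (p ∷ ps) rewrite Q-anti f g ps = lem (f p) (g p) (total f ps) (total g ps) (Q g f ps)
    where
    lem : ∀ f g F G q → f * G - g * F + - q ≡ - (g * F - f * G + q)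
    lem = solve-∀

  evenL : ∀ j (ps : List V) → length ps ≡ j ℕ.+ j → EvenL ps
  evenL zero [] e = []
  evenL (suc j) [] ()
  evenL (suc j) (a ∷ []) e with () ← trans (ℕ.suc-injective e) (ℕ.+-suc j j)
  evenL (suc j) (a ∷ b ∷ ps) e =
    pair (evenL j ps (ℕ.suc-injective (trans (ℕ.suc-injective e) (ℕ.+-suc j j))))

  total-const : ∀ t (ps : List V) → total (λ _ → t) ps ≡ + length ps * t
  total-const t [] = refl
  total-const t (p ∷ ps) = trans (cong (λ z → t + z) (total-const t ps)) (sym (ℤ.suc-* (+ length ps) t))

  Q-const : ∀ s t (ps : List V) → Q (λ _ → s) (λ _ → t) ps ≡ 0ℤ
  Q-const s t [] = refl
  Q-const s t (p ∷ ps) rewrite total-const s ps | total-const t ps | Q-const s t ps = lem s t (+ length ps)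
    where
    lem : ∀ s t l → s * (l * t) - t * (l * s) + 0ℤ ≡ 0ℤ
    lem = solve-∀

  AltFrom-∷⁻ : ∀ {f : V → ℤ} {s p ps} → AltFrom f s (p ∷ ps) → AltFrom f (not s) ps
  AltFrom-∷⁻ (e ∷ al) = al

  AltFrom-++⁻ˡ : ∀ {f : V → ℤ} {s} ps {rs} → AltFrom f s (ps ++ rs) → AltFrom f s ps
  AltFrom-++⁻ˡ [] al = []
  AltFrom-++⁻ˡ (p ∷ ps) (e ∷ al) = e ∷ AltFrom-++⁻ˡ ps al

  AltFrom-delete : ∀ {f : V → ℤ} {s} ps {a b rs} → AltFrom f s (ps ++ a ∷ b ∷ rs) → AltFrom f s (ps ++ rs)
  AltFrom-delete {f} {s} [] {rs = rs} (e ∷ (d ∷ al)) = subst (λ t → AltFrom f t rs) (not-involutive s) al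
  AltFrom-delete (p ∷ ps) (e ∷ al) = e ∷ AltFrom-delete ps al

  -- Removing two neighbours preserves the parity of all index differences; this supplies the
  -- shortened lists for the second kind of deletion, `del₂`.
  Circ-delete : ∀ {ω : Form {V}} ps {a b rs} → Circ ω (ps ++ a ∷ b ∷ rs) → Circ ω (ps ++ rs)
  Circ-delete [] (_ ∷ (_ ∷ c)) = c
  Circ-delete (p ∷ ps) (al ∷ c) = AltFrom-delete ps al ∷ Circ-delete ps c

  after : Bool → List V → Bool
  after s [] = s
  after s (p ∷ ps) = after (not s) ps

  after-not : ∀ s ps → after (not s) ps ≡ not (after s ps)
  after-not s [] = refl
  after-not s (p ∷ ps) = after-not (not s) ps

  after-even : ∀ s {ps} → EvenL ps → after s ps ≡ s
  after-even s [] = refl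
  after-even s (pair ev) = trans (after-even (not (not s)) ev) (not-involutive s)

  AltFrom-snoc : ∀ {f : V → ℤ} {s ps p} → AltFrom f s ps → f p ≡ sg (after s ps) → AltFrom f s (ps ++ p ∷ [])
  AltFrom-snoc [] e = e ∷ []
  AltFrom-snoc (d ∷ al) e = d ∷ AltFrom-snoc al e

  AltFrom-product : ∀ {f g : V → ℤ} {s ps} → AltFrom f s ps → AltFrom g true ps →
    ∀ p → p ∈ ps → f p ≡ sg s * g p
  AltFrom-product {g = g} {s} al bl p m = trans (go al bl p m) (cong (_* g p) (ℤ.*-identityʳ (sg s)))
    where
    go : ∀ {f g : V → ℤ} {s t ps} → AltFrom f s ps → AltFrom g t ps → ∀ p → p ∈ ps → f p ≡ sg s * sg t * g p
    go {s = s} {t} (e ∷ al) (d ∷ bl) p (here refl) rewrite e | d = sq s t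
      where
      sq : ∀ s t → sg s ≡ sg s * sg t * sg t
      sq true true = refl
      sq true false = refl
      sq false true = refl
      sq false false = refl
    go {f} {g} {s} {t} (e ∷ al) (d ∷ bl) p (there m) = trans (go al bl p m) (cong (_* g p) (sq s t))
      where
      sq : ∀ s t → sg (not s) * sg (not t) ≡ sg s * sg t
      sq true true = refl
      sq true false = refl
      sq false true = refl
      sq false false = refl

  module _ {ω : Form {V}} (sk : Skew ω) where

    -- The first sign `s` is generalised so that the list can be peeled from the left;
    -- `after s ps ≡ false` retains the parity that lets `p` continue every alternation at the far
    -- end.
    Circ-rot₁′ : ∀ {s p ps} → AltFrom (ω p) s ps → Circ ω ps → after s ps ≡ false → Circ ω (ps ++ p ∷ [])
    Circ-rot₁′ [] [] e = [] ∷ []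
    Circ-rot₁′ {s} {p} {r ∷ ps} (d ∷ al) (bl ∷ c) e =
      AltFrom-snoc bl (trans (anti sk r p) (trans (cong -_ d) (trans (sym (sg-not s)) (cong sg (sym (lem (not s) e)))))) ∷
      Circ-rot₁′ al c e
      where
      lem : ∀ t → after t ps ≡ false → after false ps ≡ t
      lem false e = e
      lem true e = not-injective (trans (sym (after-not false ps)) e)

    -- On a circle of odd length `k` one has `(-1)^(k - i) = - (-1)^i`, which is the sign change
    -- that antisymmetry demands when `p` moves to the end.
    Circ-rot₁ : ∀ {p ps} → EvenL ps → Circ ω (p ∷ ps) → Circ ω (ps ++ p ∷ [])
    Circ-rot₁ ev (al ∷ c) = Circ-rot₁′ al c (after-even false ev)

    ω≢0⇒≢ : ∀ {a b} s → ω a b ≡ sg s → a ≢ b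
    ω≢0⇒≢ {a} s e refl = sg≢0 s (trans (sym e) (diag sk a))

    AltFrom⇒≢ : ∀ {p s ps} → AltFrom (ω p) s ps → All (p ≢_) ps
    AltFrom⇒≢ [] = []
    AltFrom⇒≢ {s = s} (e ∷ al) = ω≢0⇒≢ s e ∷ AltFrom⇒≢ al

    Circ⇒Unique : ∀ {ps} → Circ ω ps → AllPairs _≢_ ps
    Circ⇒Unique [] = []
    Circ⇒Unique (al ∷ c) = AltFrom⇒≢ al ∷ Circ⇒Unique c

    AltFrom-flip : ∀ {p s ps} → AltFrom (ω p) s ps → AltFrom (λ r → ω r p) (not s) ps
    AltFrom-flip {p} al = AltFrom-neg (λ r → anti sk r p) al

    total-column : ∀ {h ps c} → EvenL ps → Circ ω ps → AltFrom h false ps → c ∈ ps →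
      total (λ r → ω r c) ps ≡ - h c
    total-column {h} {a ∷ b ∷ ps} (pair ev) ((d ∷ al) ∷ (bl ∷ c)) (e ∷ (e′ ∷ hl)) (here refl)
      rewrite diag sk a | anti sk b a | d | e | total-alternating ev (AltFrom-flip al) = refl
    total-column {h} {a ∷ b ∷ ps} (pair ev) ((d ∷ al) ∷ (bl ∷ c)) (e ∷ (e′ ∷ hl)) (there (here refl))
      rewrite diag sk b | d | e′ | total-alternating ev (AltFrom-flip bl) = refl
    total-column {h} {a ∷ b ∷ ps} {x} (pair ev) ((d ∷ al) ∷ (bl ∷ c)) (e ∷ (e′ ∷ hl)) (there (there m))
      rewrite alternating-opposite al bl x m | total-column ev c hl m = lem (ω b x) (h x)
      where
      lem : ∀ a b → - a + (a + - b) ≡ - b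
      lem = solve-∀

    -- Q inverts the circulant form.
    Q-inverse : ∀ {ps c} f → EvenL ps → Circ ω ps → c ∈ ps → Q f (λ r → ω r c) ps ≡ f c
    Q-inverse {a ∷ b ∷ ps} f (pair ev) ((d ∷ al) ∷ (bl ∷ c)) (here refl)
      rewrite diag sk a | anti sk b a | d | total-alternating ev (AltFrom-flip al)
            | Q-alternating f ev (AltFrom-flip al) = lem (f a) (f b) (total f ps)
      where
      lem : ∀ a b F → a * (- -1ℤ + 0ℤ) - 0ℤ * (b + F) + (b * 0ℤ - - -1ℤ * F + - (-1ℤ * F)) ≡ a
      lem = solve-∀
    Q-inverse {a ∷ b ∷ ps} f (pair ev) ((d ∷ al) ∷ (bl ∷ c)) (there (here refl))
      rewrite diag sk b | d | total-alternating ev (AltFrom-flip bl)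
            | Q-alternating f ev (AltFrom-flip bl) = lem (f a) (f b) (total f ps)
      where
      lem : ∀ a b F → a * (0ℤ + 0ℤ) - -1ℤ * (b + F) + (b * 0ℤ - 0ℤ * F + - (1ℤ * F)) ≡ b
      lem = solve-∀
    Q-inverse {a ∷ b ∷ ps} {x} f (pair ev) ((d ∷ al) ∷ (bl ∷ c)) (there (there m))
      rewrite alternating-opposite al bl x m | total-column ev c bl m | Q-inverse f ev c m =
      lem (f a) (f b) (total f ps) (ω b x) (f x)
      where
      lem : ∀ a b F w t → a * (w + - w) - - w * (b + F) + (b * - w - w * F + t) ≡ t
      lem = solve-∀

lookup-injective : ∀ {V : Set} {xs : List V} → AllPairs _≢_ xs → Injective _≡_ _≡_ (lookup xs)
lookup-injective (_ ∷ u) {zero} {zero} e = refl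
lookup-injective {xs = x ∷ xs} (a ∷ u) {zero} {suc j} e = ⊥-elim (All.lookup a (∈-lookup {xs = xs} j) e)
lookup-injective {xs = x ∷ xs} (a ∷ u) {suc i} {zero} e = ⊥-elim (All.lookup a (∈-lookup {xs = xs} i) (sym e))
lookup-injective (_ ∷ u) {suc i} {suc j} e = cong suc (lookup-injective u e)

square-within : ∀ k x → x * x ≤ + (k ℕ.* k) → Within (+ k) x
square-within k (+ m) e = ℤ.neg-≤-pos , +≤+ (sqrt m k (drop‿+≤+ (subst (_≤ + (k ℕ.* k)) (sym (ℤ.pos-* m m)) e)))
  where
  sqrt : ∀ m k → m ℕ.* m ℕ.≤ k ℕ.* k → m ℕ.≤ k
  sqrt m k le = ℕ.≮⇒≥ (λ k<m → ℕ.<⇒≱ (ℕ.*-mono-< k<m k<m) le)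
square-within k -[1+ m ] e with square-within k (+ suc m) e
... | _ , +≤+ le = ℤ.neg-mono-≤ (+≤+ le) , -≤+

skew-Skew : ∀ {n} (T : Tournament n) → Skew (skew T)
skew-Skew T .diag x rewrite irrefl T x = refl
skew-Skew T .anti x y with x ≟ y
... | yes refl rewrite irrefl T x = refl
... | no x≢y rewrite oneArc T x y x≢y with arc T y x
...   | true = refl
...   | false = refl

skew-arc : ∀ {n} (T : Tournament n) {x y} → x ≢ y → skew T x y ≡ sg (arc T x y)
skew-arc T {x} {y} x≢y rewrite oneArc T y x (x≢y ∘ sym) with arc T x y
... | true = refl
... | false = refl

-- Circulant frames in a tournament

total-↭ : ∀ {V : Set} (f : V → ℤ) {ps rs} → ps ↭ rs → total f ps ≡ total f rs
total-↭ f ↭.refl = refl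
total-↭ f (↭.prep p σ) = cong (λ t → f p + t) (total-↭ f σ)
total-↭ f (↭.swap {ps} {rs} p r σ) = cong (λ t → f p + (f r + t)) (total-↭ f σ) ▹ lem (f p) (f r) (total f rs)
  where
  lem : ∀ a b c → a + (b + c) ≡ b + (a + c)
  lem = solve-∀
total-↭ f (↭.trans σ τ) = total-↭ f σ ▹ total-↭ f τ

module _ {V : Set} (h : V → Bool) where

  total-sm : ∀ ps → total (sg ∘ h) ps ≡ sm (map h ps)
  total-sm [] = refl
  total-sm (p ∷ ps) = cong (λ t → sg (h p) + t) (total-sm ps)

  total-len : ∀ ps → total {V} (λ _ → -1ℤ) ps ≡ - len (map h ps)
  total-len [] = refl
  total-len (p ∷ ps) = cong (λ t → -1ℤ + t) (total-len ps) ▹ sym (ℤ.neg-distrib-+ 1ℤ (len (map h ps)))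

  Q-A : ∀ ps → Q (λ _ → -1ℤ) (sg ∘ h) ps ≡ - A (map h ps)
  Q-A [] = refl
  Q-A (p ∷ ps) rewrite total-sm ps | total-len ps | Q-A ps =
    lem (sg (h p)) (sm (map h ps)) (len (map h ps)) (A (map h ps))
    where
    lem : ∀ a σ l x → -1ℤ * σ - a * (- l) + - x ≡ - (σ - l * a + x)
    lem = solve-∀

  map-split : ∀ ps {v w} → map h ps ≡ v ++ w →
    ∃ λ ps₁ → ∃ λ ps₂ → ps ≡ ps₁ ++ ps₂ × map h ps₁ ≡ v × map h ps₂ ≡ w
  map-split ps {[]} e = [] , ps , refl , refl , e
  map-split (p ∷ ps) {a ∷ v} e with e₁ , e₂ ← ∷-injective e
    with ps₁ , ps₂ , refl , d₁ , d₂ ← map-split ps {v} e₂ =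
    p ∷ ps₁ , ps₂ , refl , cong₂ _∷_ e₁ d₁ , d₂

  AltFrom-map⁻ : ∀ {s} ps → AltFrom sg s (map h ps) → AltFrom (sg ∘ h) s ps
  AltFrom-map⁻ [] [] = []
  AltFrom-map⁻ (p ∷ ps) (e ∷ al) = e ∷ AltFrom-map⁻ ps al

sm-not : ∀ w → sm (map not w) ≡ - sm w
sm-not [] = refl
sm-not (a ∷ w) rewrite sg-not a | sm-not w = sym (ℤ.neg-distrib-+ (sg a) (sm w))

len-map : ∀ (f : Bool → Bool) w → len (map f w) ≡ len w
len-map f [] = refl
len-map f (a ∷ w) = cong (λ t → 1ℤ + t) (len-map f w)

A-not : ∀ w → A (map not w) ≡ - A w
A-not [] = refl
A-not (a ∷ w) rewrite sg-not a | sm-not w | A-not w | len-map not w = lem (sg a) (sm w) (len w) (A w)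
  where
  lem : ∀ a σ l x → - σ - l * (- a) + - x ≡ - (σ - l * a + x)
  lem = solve-∀

AltFrom-not : ∀ {s w} → AltFrom sg s w → AltFrom sg (not s) (map not w)
AltFrom-not [] = []
AltFrom-not {s} (_∷_ {p = p} e al) = (sg-not p ▹ (cong -_ e ▹ sym (sg-not s))) ∷ AltFrom-not al

Within-neg : ∀ {K x} → Within K x → Within K (- x)
Within-neg {K} {x} (l , u) = ℤ.neg-mono-≤ u , subst (- x ≤_) (ℤ.neg-involutive K) (ℤ.neg-mono-≤ l)

nonempty : ∀ {V : Set} {m} (ps : List V) → length ps ≡ suc m → ∃ λ p → p ∈ ps
nonempty (p ∷ ps) e = p , here refl

module Frames {n} (T : Tournament n) (j : ℕ) (D : InD (suc (j ℕ.+ j)) T)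
  (ps₀ : List (Fin n)) (q : Fin n) (circ₀ : Circ (skew T) ps₀) (size₀ : length ps₀ ≡ suc (j ℕ.+ j))
  (apex : ∀ p → p ∈ ps₀ → skew T p q ≡ -1ℤ)
  where

  K : ℤ
  K = + suc (j ℕ.+ j)

  ω : Fin n → Fin n → ℤ
  ω = skew T

  sk : Skew ω
  sk = skew-Skew T

  vs₀ : List (Fin n)
  vs₀ = q ∷ ps₀

  q∉ps₀ : ∀ r → r ∈ ps₀ → r ≢ q
  q∉ps₀ r m = ω≢0⇒≢ sk false (apex r m)

  bound : ∀ {xs} → AllPairs _≢_ xs → det (gram ω xs) ≤ + (suc (j ℕ.+ j) ℕ.* suc (j ℕ.+ j))
  bound {xs} u = D (length xs) (lookup xs) (lookup-injective u)

  unique-snoc₂ : ∀ {e : List (Fin n)} {u v} → AllPairs _≢_ e → (∀ r → r ∈ e → r ≢ u) → (∀ r → r ∈ e → r ≢ v) → u ≢ v →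
    AllPairs _≢_ (e ++ u ∷ v ∷ [])
  unique-snoc₂ ue eu ev u≢v = AllPairs.++⁺ ue ((u≢v ∷ []) ∷ [] ∷ [])
    (All.tabulate (λ m → eu _ m ∷ ev _ m ∷ []))

  pf-within : ∀ {e u v} → EvenL e → Circ ω e → (∀ r → r ∈ e → r ≢ u) → (∀ r → r ∈ e → r ≢ v) → u ≢ v →
    Within K (pf ω e u v)
  pf-within {e} {u} {v} ev c eu ev′ u≢v = square-within _ (pf ω e u v)
    (subst (_≤ _) (det-chain u v sk ev c) (bound (unique-snoc₂ (Circ⇒Unique sk c) eu ev′ u≢v)))

  -- Both forms have to be circulant on `e`: circulance of `ω` makes the entries of `e` distinct,
  -- circulance of the pivoted form makes the remaining determinant a square.
  pivot-within : ∀ {a b e u v} → ω a b ≡ -1ℤ → EvenL e → Circ ω e → Circ (pivot ω a b) e →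
    (∀ r → r ∈ e → r ≢ a) → (∀ r → r ∈ e → r ≢ b) → (∀ r → r ∈ e → r ≢ u) → (∀ r → r ∈ e → r ≢ v) →
    u ≢ v → a ≢ u → a ≢ v → b ≢ u → b ≢ v → Within K (pf (pivot ω a b) e u v)
  pivot-within {a} {b} {e} {u} {v} ab ev c c′ ea eb eu ev′ u≢v a≢u a≢v b≢u b≢v =
    square-within _ (pf (pivot ω a b) e u v)
      (subst (_≤ _) (det-gram-pivot sk a b (e ++ u ∷ v ∷ []) ab ▹ det-chain u v (pivot-skew a b sk) ev c′)
        (bound ((ω≢0⇒≢ sk false ab ∷ outside ea a≢u a≢v) ∷ outside eb b≢u b≢v ∷
          unique-snoc₂ (Circ⇒Unique sk c) eu ev′ u≢v)))
    where
    outside : ∀ {a} → (∀ r → r ∈ e → r ≢ a) → a ≢ u → a ≢ v → All (a ≢_) (e ++ u ∷ v ∷ [])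
    outside ea a≢u a≢v = All.++⁺ (All.tabulate (λ m → ea _ m ∘ sym)) (a≢u ∷ a≢v ∷ [])

  -- The rotations of the circle enter through their signs and their vertices, so a frame is
  -- recorded as a circulant permutation of `ps₀`.
  Frame : List (Fin n) → Set
  Frame ps = Circ ω ps × ps ↭ ps₀

  frame-size : ∀ {ps} → Frame ps → length ps ≡ suc (j ℕ.+ j)
  frame-size (_ , σ) = ↭.↭-length σ ▹ size₀

  frame-even : ∀ {p ps} → Frame (p ∷ ps) → EvenL ps
  frame-even fr = evenL j _ (ℕ.suc-injective (frame-size fr))

  frame-rot₁ : ∀ {p ps} → Frame (p ∷ ps) → Frame (ps ++ p ∷ [])
  frame-rot₁ {p} {ps} fr@(c , σ) = Circ-rot₁ sk (frame-even fr) c , ↭-trans (↭.++-comm ps (p ∷ [])) σ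

  frame-rot : ∀ v {w} → Frame (v ++ w) → Frame (w ++ v)
  frame-rot [] {w} p = subst Frame (sym (++-identityʳ w)) p
  frame-rot (a ∷ v) {w} p = subst Frame (++-assoc w (a ∷ []) v)
    (frame-rot v (subst Frame (++-assoc v w (a ∷ [])) (frame-rot₁ p)))

  frame-front : ∀ {p} → p ∈ ps₀ → ∃ λ rest → Frame (p ∷ rest)
  frame-front m with xs , ys , refl ← ∈-∃++ m = _ , frame-rot xs (circ₀ , ↭-refl)

  frame-∈ : ∀ {ps r} → Frame ps → r ∈ ps → r ∈ ps₀
  frame-∈ (_ , σ) m = ↭.∈-resp-↭ σ m

  frame-∋ : ∀ {ps r} → Frame ps → r ∈ ps₀ → r ∈ ps
  frame-∋ (_ , σ) m = ↭.∈-resp-↭ (↭-sym σ) m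

  tail-∋ : ∀ {p rest r} → Frame (p ∷ rest) → r ∈ ps₀ → r ≢ p → r ∈ rest
  tail-∋ fr m r≢p with frame-∋ fr m
  ... | here e = ⊥-elim (r≢p e)
  ... | there m′ = m′

  tail-≢ : ∀ {p rest r} → Frame (p ∷ rest) → r ∈ rest → r ≢ p
  tail-≢ (al ∷ c , _) m e = All.lookup (AltFrom⇒≢ sk al) m (sym e)

  ω-q : ∀ p → p ∈ ps₀ → ω q p ≡ 1ℤ
  ω-q p m = anti sk q p ▹ cong -_ (apex p m)

  -- Outside vertices are signed twins of frame vertices

  Similar : Bool → Fin n → Fin n → Set
  Similar ε x p = ∀ r → r ∈ vs₀ → r ≢ p → ω r x ≡ sg ε * ω r p

  Clone : Fin n → Set
  Clone x = ∃ λ p → p ∈ vs₀ × ∃ λ ε → Similar ε x p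

  module Vertex (x : Fin n) (x∉ : ∀ r → r ∈ vs₀ → r ≢ x) where

    h : Fin n → Bool
    h p = arc T p x

    ω-h : ∀ r → r ∈ vs₀ → ω r x ≡ sg (h r)
    ω-h r m = skew-arc T (x∉ r m)

    pf-A : ∀ e → (∀ r → r ∈ e → r ∈ ps₀) → pf ω e q x ≡ ω q x - A (map h e)
    pf-A e sub = cong (λ t → ω q x + t)
      (Q-cong e (λ p m → apex p (sub p m)) (λ p m → ω-h p (there (sub p m))) ▹ Q-A h e)

    within-A : ∀ e → (∀ r → r ∈ e → r ∈ ps₀) → EvenL e → Circ ω e → Within K (ω q x - A (map h e))
    within-A e sub ev c = subst (Within K) (pf-A e sub)
      (pf-within ev c (λ r m → q∉ps₀ r (sub r m)) (λ r m → x∉ r (there (sub r m))) (x∉ q (here refl)))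

    Reach : List Bool → Set
    Reach w = ∃ λ ps → Frame ps × map h ps ≡ w

    s : ℤ
    s = sm (map h ps₀)

    reach-rot₁ : ∀ {a w} → Reach (a ∷ w) → Reach (w ++ a ∷ [])
    reach-rot₁ (p ∷ ps , fr , refl) = ps ++ p ∷ [] , frame-rot₁ fr , map-++ h ps (p ∷ [])

    reach-size : ∀ {w} → Reach w → length w ≡ suc (j ℕ.+ j)
    reach-size (ps , fr , refl) = length-map h ps ▹ frame-size fr

    reach-sum : ∀ {w} → Reach w → sm w ≡ s
    reach-sum (ps , (_ , σ) , refl) = sym (total-sm h ps) ▹ (total-↭ (sg ∘ h) σ ▹ total-sm h ps₀)

    reach-del₁ : ∀ {a e} → Reach (a ∷ e) → Within K (ω q x - A e)
    reach-del₁ (p ∷ ps , fr@(_ ∷ c , _) , refl) =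
      within-A ps (λ r m → frame-∈ fr (there m)) (frame-even fr) c

    reach-del₂ : ∀ {a y z} e₁ {e₂} → Reach (a ∷ e₁ ++ y ∷ z ∷ e₂) → Within K (ω q x - A (e₁ ++ e₂))
    reach-del₂ e₁ {e₂} (p ∷ ps , fr@(_ ∷ c , _) , e)
      with ps₁ , y ∷ z ∷ ps₂ , refl , refl , refl ← map-split h ps {e₁} (∷-injectiveʳ e) =
      subst (λ t → Within K (ω q x - A t)) (map-++ h ps₁ ps₂)
        (within-A (ps₁ ++ ps₂) sub (even-delete ps₁ (frame-even fr)) (Circ-delete ps₁ c))
      where
      sub : ∀ r → r ∈ ps₁ ++ ps₂ → r ∈ ps₀
      sub r m with ∈-++⁻ ps₁ m
      ... | inj₁ m′ = frame-∈ fr (there (∈-++⁺ˡ m′))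
      ... | inj₂ m′ = frame-∈ fr (there (∈-++⁺ʳ ps₁ (there (there m′))))
      even-delete : ∀ {V : Set} (as : List V) {b c bs} → EvenL (as ++ b ∷ c ∷ bs) → EvenL (as ++ bs)
      even-delete [] (pair ev) = ev
      even-delete (a ∷ []) (pair (ev)) = even-cons ev
        where
        even-cons : ∀ {V : Set} {a c : V} {bs} → EvenL (c ∷ bs) → EvenL (a ∷ bs)
        even-cons (pair ev) = pair ev
      even-delete (a ∷ a′ ∷ as) (pair ev) = pair (even-delete as ev)

    -- A constant word belongs to the apex. An alternating word of odd length begins and ends with
    -- the same letter; off the vertex itself it agrees up to sign with the column of the first
    -- vertex and with that of the last one, these two signs are opposite, and the entry at `q`
    -- decides between them.
    clone-of-shape : ∀ b {w} → Reach w → All (_≡ b) w ⊎ AltFrom sg b w → Clone x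
    clone-of-shape b (ps , fr , refl) (inj₁ all) = q , here refl , not b , sim
      where
      sim : Similar (not b) x q
      sim r (here refl) r≢q = ⊥-elim (r≢q refl)
      sim r (there m) _ = ω-h r (there m) ▹
        (cong sg (All.lookup (All.map⁻ all) (frame-∋ fr m)) ▹
        (lem b ▹ cong (λ t → sg (not b) * t) (sym (apex r m))))
        where
        lem : ∀ b → sg b ≡ sg (not b) * -1ℤ
        lem true = refl
        lem false = refl
    clone-of-shape b (ps , fr , refl) (inj₂ alt) with h q Bool.≟ b
    clone-of-shape b ([] , fr , refl) (inj₂ alt) | no _ with () ← frame-size fr
    clone-of-shape b (p ∷ rest , fr@(al ∷ c , _) , refl) (inj₂ alt) | no hq≢b =
      p , there (frame-∈ fr (here refl)) , not b , sim
      where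
      sim : Similar (not b) x p
      sim r (here refl) _ = ω-h r (here refl) ▹
        (cong sg (¬-not hq≢b) ▹
        (sym (ℤ.*-identityʳ (sg (not b))) ▹ cong (λ t → sg (not b) * t) (sym (ω-q p (frame-∈ fr (here refl))))))
      sim r (there m) r≢p = ω-h r (there m) ▹
        AltFrom-product (AltFrom-∷⁻ (AltFrom-map⁻ h (p ∷ rest) alt)) (AltFrom-flip sk al) r (tail-∋ fr m r≢p)
    clone-of-shape b (ps , fr , refl) (inj₂ alt) | yes hq≡b with initLast ps
    ... | [] with () ← frame-size fr
    ... | init ∷ʳ′ p = front (frame-rot init fr)
      where
      front : Frame (p ∷ init) → Clone x
      front fr′@(al ∷ c , _) = p , there (frame-∈ fr′ (here refl)) , b , sim
        where
        sim : Similar b x p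
        sim r (here refl) _ = ω-h r (here refl) ▹
          (cong sg hq≡b ▹
          (sym (ℤ.*-identityʳ (sg b)) ▹ cong (λ t → sg b * t) (sym (ω-q p (frame-∈ fr′ (here refl))))))
        sim r (there m) r≢p = ω-h r (there m) ▹
          AltFrom-product (AltFrom-++⁻ˡ init (AltFrom-map⁻ h (init ++ p ∷ []) alt)) (AltFrom-flip sk al)
            r (tail-∋ fr′ m r≢p)

    reach₀ : Reach (map h ps₀)
    reach₀ = ps₀ , (circ₀ , ↭-refl) , refl

    -- The sum of the word is odd, hence not zero. A negative sum is made positive by complementing
    -- the word, which negates `A`; with the constant `ω q x` negated as well, the bounds merely
    -- change sign.
    clone : Clone x
    clone with ℤ.<-cmp 0ℤ s
    ... | tri< s>0 _ _ with w , r , sh ← CyclicWord.shape j (ω q x) s Reach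
            reach-rot₁ reach-size reach-sum reach-del₁ reach-del₂ s>0 reach₀ = clone-of-shape true r sh
    ... | tri≈ _ s≡0 _ = ⊥-elim (sm-odd {map h ps₀} j (reach-size reach₀) 0ℤ (sym s≡0))
    ... | tri> _ _ s<0 = flipped
      where
      P : List Bool → Set
      P w = Reach (map not w)
      back : ∀ e → Within K (ω q x - A (map not e)) → Within K (- ω q x - A e)
      back e w = subst (Within K) (cong (λ t → - (ω q x - t)) (A-not e) ▹ lem (ω q x) (A e)) (Within-neg w)
        where
        lem : ∀ c a → - (c - - a) ≡ - c - a
        lem = solve-∀
      map-not² : ∀ w → map not (map not w) ≡ w
      map-not² [] = refl
      map-not² (a ∷ w) = cong₂ _∷_ (not-involutive a) (map-not² w)
      flipped : Clone x
      flipped with w , r , sh ← CyclicWord.shape j (- ω q x) (- s) P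
              (λ {a} {w} r → subst Reach (sym (map-++ not w (a ∷ []))) (reach-rot₁ r))
              (λ {w} r → sym (length-map not w) ▹ reach-size r)
              (λ {w} r → sym (ℤ.neg-involutive (sm w)) ▹ cong -_ (sym (sm-not w) ▹ reach-sum r))
              (λ {a} {e} r → back e (reach-del₁ r))
              (λ {a} {y} {z} e₁ {e₂} r → back (e₁ ++ e₂)
                (subst (λ t → Within K (ω q x - A t)) (sym (map-++ not e₁ e₂))
                  (reach-del₂ (map not e₁) (subst (λ t → Reach (not a ∷ t)) (map-++ not e₁ (y ∷ z ∷ e₂)) r))))
              (ℤ.neg-mono-< s<0)
              (subst Reach (sym (map-not² (map h ps₀))) reach₀)
        with sh
      ... | inj₁ all = clone-of-shape false r (inj₁ (All.map⁺ (All.map (cong not) all)))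
      ... | inj₂ alt = clone-of-shape false r (inj₂ (AltFrom-not alt))

  -- This is the Pfaffian of the whole of `vs₀`, up to sign: the bound `K` is attained.
  apex-pf : ∀ {p rest} → Frame (p ∷ rest) → pf ω rest q p ≡ K
  apex-pf {p} {rest} fr@(al ∷ c , _) =
    cong₂ _+_ (ω-q p (frame-∈ fr (here refl)))
      (Q-cong rest (λ r m → apex r (frame-∈ fr (there m))) (λ _ _ → refl) ▹
      Q-alternating (λ _ → -1ℤ) (frame-even fr) (AltFrom-flip sk al)) ▹
    (cong (λ t → 1ℤ + - (1ℤ * t)) (total-const -1ℤ rest) ▹
    (lem (+ length rest) ▹ cong +_ (frame-size fr)))
    where
    lem : ∀ l → 1ℤ + - (1ℤ * (l * -1ℤ)) ≡ 1ℤ + l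
    lem = solve-∀

  -- Pivoting on twins

  Twin : Fin n → Fin n → Set
  Twin x p = ∀ r → r ∈ vs₀ → r ≢ p → ω r x ≡ ω r p

  twin-≢ : ∀ {x p r} → Twin x p → r ∈ vs₀ → r ≢ p → r ≢ x
  twin-≢ tw m r≢p = ω≢0⇒≢ sk _ (tw _ m r≢p ▹ skew-arc T r≢p)

  module _ {a b p u : Fin n} {rest : List (Fin n)} (ta : Twin a p) (tb : Twin b p) (ab : ω a b ≡ -1ℤ)
    (ev : EvenL rest) (c : Circ ω rest)
    (inside : ∀ r → r ∈ rest → r ∈ vs₀) (rest≢p : ∀ r → r ∈ rest → r ≢ p) (rest≢u : ∀ r → r ∈ rest → r ≢ u)
    (u∈ : u ∈ vs₀) (u≢p : u ≢ p) where

    private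
      same : ∀ {r s} → ω r a ≡ ω r b → ω s a ≡ ω s b → pivot ω a b r s ≡ ω r s
      same {r} {s} e d rewrite anti sk a s | anti sk b s | e | d = lem (ω r s) (ω r b) (ω s b)
        where
        lem : ∀ x y z → x - y * (- z) + y * (- z) ≡ x
        lem = solve-∀

      equal : ∀ {r} → r ∈ vs₀ → r ≢ p → ω r a ≡ ω r b
      equal m r≢p = ta _ m r≢p ▹ sym (tb _ m r≢p)

      column : ∀ {r} v → r ∈ vs₀ → r ≢ p → pivot ω a b r v ≡ ω r v + (ω a v - ω b v) * ω r p
      column {r} v m r≢p rewrite ta r m r≢p | tb r m r≢p = lem (ω r v) (ω r p) (ω a v) (ω b v)
        where
        lem : ∀ x w s t → x - w * t + w * s ≡ x + (s - t) * w
        lem = solve-∀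

    -- The columns of `a` and `b` agree away from `p`, so the pivot leaves `rest` and `u` unchanged
    -- and adds to the column of `v` a multiple of the column of `p`; `pf` is linear in that column.
    pf-twins : ∀ v → pf (pivot ω a b) rest u v ≡ pf ω rest u v + (ω a v - ω b v) * pf ω rest u p
    pf-twins v =
      cong₂ _+_ (column v u∈ u≢p)
        (Q-cong rest
          (λ r m → same (equal (inside r m) (rest≢p r m)) (equal u∈ u≢p))
          (λ r m → column v (inside r m) (rest≢p r m)) ▹
        Q-linearʳ (λ r → ω r u) (λ r → ω r v) (ω a v - ω b v) (λ r → ω r p) rest) ▹
      lem (ω u v) (ω a v - ω b v) (ω u p) _ _
      where
      lem : ∀ x t y q₁ q₂ → (x + t * y) + (q₁ + t * q₂) ≡ (x + q₁) + t * (y + q₂)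
      lem = solve-∀

    twins-within : ∀ v → (∀ r → r ∈ rest → r ≢ v) → u ≢ v → a ≢ v → b ≢ v →
      Within K (pf ω rest u v + (ω a v - ω b v) * pf ω rest u p)
    twins-within v rest≢v u≢v a≢v b≢v = subst (Within K) (pf-twins v)
      (pivot-within ab ev c
        (Circ-cong (λ r s m m′ → same (equal (inside r m) (rest≢p r m)) (equal (inside s m′) (rest≢p s m′))) c)
        (λ r m → twin-≢ ta (inside r m) (rest≢p r m)) (λ r m → twin-≢ tb (inside r m) (rest≢p r m))
        rest≢u rest≢v u≢v (twin-≢ ta u∈ u≢p ∘ sym) a≢v (twin-≢ tb u∈ u≢p ∘ sym) b≢v)

  tail-inside : ∀ {p rest} → Frame (p ∷ rest) → ∀ r → r ∈ rest → r ∈ vs₀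
  tail-inside fr r m = there (frame-∈ fr (there m))

  twin-refl : ∀ p → Twin p p
  twin-refl p r _ _ = refl

  3K-absurd : ∀ s → Within K (sg s * K + + 2 * (sg s * K)) → ⊥
  3K-absurd true (_ , le) = ℤ.<⇒≱ pos (subst (_≤ 0ℤ) (lem K) (ℤ.i≤j⇒i-j≤0 le))
    where
    lem : ∀ K → 1ℤ * K + + 2 * (1ℤ * K) - K ≡ K + K
    lem = solve-∀
    pos : 0ℤ < K + K
    pos = +<+ (ℕ.s≤s ℕ.z≤n)
  3K-absurd false w = 3K-absurd true (subst (Within K) (lem K) (Within-neg w))
    where
    lem : ∀ K → - (-1ℤ * K + + 2 * (-1ℤ * K)) ≡ 1ℤ * K + + 2 * (1ℤ * K)
    lem = solve-∀

  -- Replacing a vertex of the frame by a cyclic triangle of twins triples the Pfaffian.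
  no-cyclic-twins : ∀ {p x y z} → p ∈ vs₀ → Twin x p → Twin y p → Twin z p →
    ω x y ≡ 1ℤ → ω y z ≡ 1ℤ → ω z x ≡ 1ℤ → ⊥
  no-cyclic-twins {p} {x} {y} {z} p∈ tx ty tz xy yz zx = frame p∈
    where
    yx : ω y x ≡ -1ℤ
    yx = anti sk y x ▹ cong -_ xy
    xz : ω x z ≡ -1ℤ
    xz = anti sk x z ▹ cong -_ zx
    triple : ∀ {rest u} s → EvenL rest → Circ ω rest →
      (∀ r → r ∈ rest → r ∈ vs₀) → (∀ r → r ∈ rest → r ≢ p) → (∀ r → r ∈ rest → r ≢ u) →
      u ∈ vs₀ → u ≢ p → pf ω rest u p ≡ sg s * K → ⊥
    -- The pivot is on `y` and `x`. The twin `z` contributes the same Pfaffian `sg s * K` as `p`,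
    -- and `ω y z - ω x z = 2` adds twice that.
    triple {rest} {u} s ev c inside r≢p r≢u u∈ u≢p e = 3K-absurd s
      (subst (Within K)
        (cong₂ _+_
          (cong₂ _+_ (tz u u∈ u≢p) (Q-cong rest (λ _ _ → refl) (λ r m → tz r (inside r m) (r≢p r m))) ▹ e)
          (cong₂ _*_ (cong₂ _-_ yz xz) e))
        (twins-within ty tx yx ev c inside r≢p r≢u u∈ u≢p z
          (λ r m → twin-≢ tz (inside r m) (r≢p r m)) (twin-≢ tz u∈ u≢p)
          (ω≢0⇒≢ sk true yz) (ω≢0⇒≢ sk false xz)))
    frame : p ∈ vs₀ → ⊥
    frame (there p∈) with rest , fr@(_ ∷ c , _) ← frame-front p∈ =
      triple true (frame-even fr) c (tail-inside fr) (λ r m → tail-≢ fr m)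
        (λ r m → q∉ps₀ r (frame-∈ fr (there m))) (here refl) (q∉ps₀ p p∈ ∘ sym)
        (apex-pf fr ▹ sym (ℤ.*-identityˡ K))
    -- For twins of the apex, a circle vertex `p₀` and `q` exchange roles over the same `rest`,
    -- which turns the Pfaffian `K` into `- K`.
    frame (here refl) with p₀ , p₀∈ ← nonempty ps₀ size₀ with rest , fr@(_ ∷ c , _) ← frame-front p₀∈ =
      triple false (frame-even fr) c (tail-inside fr) (λ r m → q∉ps₀ r (frame-∈ fr (there m)))
        (λ r m → tail-≢ fr m) (there p₀∈) (q∉ps₀ p₀ p₀∈)
        (cong₂ _+_ (anti sk p₀ q) (Q-anti (λ r → ω r p₀) (λ r → ω r q) rest) ▹
        (sym (ℤ.neg-distrib-+ (ω q p₀) _) ▹ (cong -_ (apex-pf fr) ▹ sym (ℤ.-1*i≡-i K))))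

  -- Arcs between twins of different vertices

  module _ (c : Fin n) where

    -- On the frame the column of a twin of `c` can differ from that of `c` only in the entry at
    -- `c`, that is, by a multiple of this vector.
    indicator : Fin n → ℤ
    indicator r with r ≟ c
    ... | yes _ = 1ℤ
    ... | no _ = 0ℤ

    indicator-at : indicator c ≡ 1ℤ
    indicator-at with c ≟ c
    ... | yes _ = refl
    ... | no c≢c = ⊥-elim (c≢c refl)

    indicator-off : ∀ {r} → r ≢ c → indicator r ≡ 0ℤ
    indicator-off {r} r≢c with r ≟ c
    ... | yes e = ⊥-elim (r≢c e)
    ... | no _ = refl

    total-indicator-∉ : ∀ ps → All (c ≢_) ps → total indicator ps ≡ 0ℤ
    total-indicator-∉ [] [] = refl
    total-indicator-∉ (p ∷ ps) (c≢p ∷ a) rewrite indicator-off (c≢p ∘ sym) | total-indicator-∉ ps a = refl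

    Q-indicator-∉ : ∀ f ps → All (c ≢_) ps → Q f indicator ps ≡ 0ℤ
    Q-indicator-∉ f [] [] = refl
    Q-indicator-∉ f (p ∷ ps) (c≢p ∷ a)
      rewrite indicator-off (c≢p ∘ sym) | total-indicator-∉ ps a | Q-indicator-∉ f ps a = lem (f p) (total f ps)
      where
      lem : ∀ x y → x * 0ℤ - 0ℤ * y + 0ℤ ≡ 0ℤ
      lem = solve-∀

    total-indicator : ∀ {ps} → AllPairs _≢_ ps → c ∈ ps → total indicator ps ≡ 1ℤ
    total-indicator {c ∷ ps} (a ∷ u) (here refl) rewrite indicator-at | total-indicator-∉ ps a = refl
    total-indicator {p ∷ ps} (a ∷ u) (there m)
      rewrite indicator-off {p} (All.lookup a m) | total-indicator u m = refl

    -- `x` and `y` count the elements of `ps` before and after `c`.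
    Q-indicator : ∀ {ps} → AllPairs _≢_ ps → c ∈ ps →
      ∃ λ x → ∃ λ y → length ps ≡ suc (x ℕ.+ y) × Q (λ _ → -1ℤ) indicator ps ≡ + y - + x
    Q-indicator {c ∷ ps} (a ∷ u) (here refl) = 0 , length ps , refl , eq
      where
      lem : ∀ l → -1ℤ * 0ℤ - 1ℤ * (l * -1ℤ) + 0ℤ ≡ l - 0ℤ
      lem = solve-∀
      eq : -1ℤ * total indicator ps - indicator c * total (λ _ → -1ℤ) ps + Q (λ _ → -1ℤ) indicator ps ≡
        + length ps - + 0
      eq rewrite indicator-at | total-indicator-∉ ps a | Q-indicator-∉ (λ _ → -1ℤ) ps a =
        cong (λ t → -1ℤ * 0ℤ - 1ℤ * t + 0ℤ) (total-const -1ℤ ps) ▹ lem (+ length ps)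
    Q-indicator {p ∷ ps} (a ∷ u) (there m) with x , y , e , d ← Q-indicator u m =
      suc x , y , cong suc e , eq
      where
      lem : ∀ t x y → -1ℤ * 1ℤ - 0ℤ * t + (y - x) ≡ y - (1ℤ + x)
      lem = solve-∀
      eq : -1ℤ * total indicator ps - indicator p * total (λ _ → -1ℤ) ps + Q (λ _ → -1ℤ) indicator ps ≡
        + y - + suc x
      eq rewrite indicator-off {p} (All.lookup a m) | total-indicator u m | d =
        lem (total (λ _ → -1ℤ) ps) (+ x) (+ y)

  -- `|x| < K`, with both gaps given as successors so that a violated bound is refuted by
  -- computation.
  Strict : ℤ → Set
  Strict x = ∃ (λ m → x + K ≡ + suc m) × ∃ (λ m → K - x ≡ + suc m)

  Strict-sg : ∀ s {x} → Strict x → Strict (sg s * x)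
  Strict-sg true {x} st = subst Strict (sym (ℤ.*-identityˡ x)) st
  Strict-sg false {x} ((m , e) , (m′ , e′)) = (m′ , (l₁ x K ▹ e′)) , (m , (l₂ x K ▹ e))
    where
    l₁ : ∀ x K → -1ℤ * x + K ≡ K - x
    l₁ = solve-∀
    l₂ : ∀ x K → K - -1ℤ * x ≡ x + K
    l₂ = solve-∀

  shift-absurd : ∀ s {x} → Strict x → Within K (x + (+ 2 * sg s) * K) → ⊥
  shift-absurd true {x} ((m , e) , _) (_ , le) with
    subst (_≤ 0ℤ) (lem x K ▹ e) (ℤ.i≤j⇒i-j≤0 le)
    where
    lem : ∀ x K → x + (+ 2 * 1ℤ) * K - K ≡ x + K
    lem = solve-∀
  ... | +≤+ ()
  shift-absurd false {x} st w =
    shift-absurd true { - x} (subst Strict (ℤ.-1*i≡-i x) (Strict-sg false {x} st)) (subst (Within K) (lem x K) (Within-neg w))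
    where
    lem : ∀ x K → - (x + (+ 2 * -1ℤ) * K) ≡ - x + (+ 2 * 1ℤ) * K
    lem = solve-∀

  module _ (j>0 : 0 ℕ.< j) where

    -- The gap `K - 1` is `j + j`, positive because of `j>0`.
    one-strict : Strict 1ℤ
    one-strict = (_ , refl) , double j j>0
      where
      double : ∀ i → 0 ℕ.< i → ∃ λ m → + (i ℕ.+ i) ≡ + suc m
      double (suc i) _ = _ , refl

    -- With `p′` in place of `y` a vertex would be repeated and the value would be zero, so only the
    -- entry between `p′` and `y` contributes: `± 1` if `p′` is the apex, and otherwise `±` the
    -- difference of the numbers of elements of `rest` after and before `p′`, which together make
    -- `K - 2`.
    replaced-strict : ∀ {p p′ y rest} → Frame (p ∷ rest) → p′ ∈ vs₀ → p ≢ p′ → Twin y p′ → p′ ≢ y →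
      Strict (pf ω rest q y)
    replaced-strict {p} {p′} {y} {rest} fr (here refl) p≢p′ ty p′≢y =
      subst Strict (sym eq) (Strict-sg (arc T q y) {1ℤ} one-strict)
      where
      eq : pf ω rest q y ≡ sg (arc T q y) * 1ℤ
      eq = cong₂ _+_ (skew-arc T p′≢y)
        (Q-cong rest (λ r m → apex r (frame-∈ fr (there m)))
          (λ r m → ty r (tail-inside fr r m) (q∉ps₀ r (frame-∈ fr (there m))) ▹ apex r (frame-∈ fr (there m))) ▹
        Q-const -1ℤ -1ℤ rest) ▹
        (ℤ.+-identityʳ (sg (arc T q y)) ▹ sym (ℤ.*-identityʳ (sg (arc T q y))))
    replaced-strict {p} {p′} {y} {rest} fr@(_ ∷ c , _) (there p′∈) p≢p′ ty p′≢y
      with m ← tail-∋ fr p′∈ (p≢p′ ∘ sym)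
      with x , z , size , e ← Q-indicator p′ (Circ⇒Unique sk c) m =
      subst Strict (sym eq) (Strict-sg t {+ z - + x} (difference x z (cong +_ (sym (frame-size fr)) ▹ cong (λ l → + suc l) size)))
      where
      t : Bool
      t = arc T p′ y
      value : ∀ r → r ∈ rest → ω r y ≡ ω r p′ + sg t * indicator p′ r
      value r m with r ≟ p′
      ... | yes refl = skew-arc T p′≢y ▹ (lem (sg t) ▹
              cong (λ z → z + sg t * 1ℤ) (sym (diag sk r)))
        where
        lem : ∀ s → s ≡ 0ℤ + s * 1ℤ
        lem = solve-∀
      ... | no r≢p′ = ty r (tail-inside fr r m) r≢p′ ▹ lem (ω r p′) (sg t)
        where
        lem : ∀ s t → s ≡ s + t * 0ℤ
        lem = solve-∀
      eq : pf ω rest q y ≡ sg t * (+ z - + x)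
      eq = cong₂ _+_ (ty q (here refl) (q∉ps₀ p′ p′∈ ∘ sym) ▹ ω-q p′ p′∈)
        (Q-cong rest (λ r m → apex r (frame-∈ fr (there m))) value ▹
        (Q-linearʳ (λ _ → -1ℤ) (λ r → ω r p′) (sg t) (indicator p′) rest ▹
        cong₂ (λ a b → a + sg t * b) (Q-inverse sk (λ _ → -1ℤ) (frame-even fr) c m) e)) ▹
        lem (sg t) (+ z - + x)
        where
        lem : ∀ s d → 1ℤ + (-1ℤ + s * d) ≡ s * d
        lem = solve-∀
      difference : ∀ x z → K ≡ + suc (suc (x ℕ.+ z)) → Strict (+ z - + x)
      difference x z e =
        (_ , (cong (λ k → (+ z - + x) + k) e ▹ l₁ (+ x) (+ z))) ,
        (_ , (cong (λ k → k - (+ z - + x)) e ▹ l₂ (+ x) (+ z)))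
        where
        l₁ : ∀ x z → (z - x) + (1ℤ + (1ℤ + (x + z))) ≡ 1ℤ + (1ℤ + (z + z))
        l₁ = solve-∀
        l₂ : ∀ x z → (1ℤ + (1ℤ + (x + z))) - (z - x) ≡ 1ℤ + (1ℤ + (x + x))
        l₂ = solve-∀

    -- A wrong arc between twins of different vertices shifts a Pfaffian of modulus below K by 2 K.
    twins-arc : ∀ {p p′ x y} → p ∈ ps₀ → p′ ∈ vs₀ → p ≢ p′ → Twin x p → Twin y p′ → x ≢ y →
      arc T x y ≡ arc T p p′
    twins-arc {p} {p′} {x} {y} p∈ p′∈ p≢p′ tx ty x≢y with arc T x y Bool.≟ arc T p p′
    ... | yes e = e
    ... | no wrong with rest , fr@(_ ∷ c , _) ← frame-front p∈ = ⊥-elim (contra (arc T p x) refl)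
      where
      py : ω p y ≡ ω p p′
      py = ty p (there p∈) p≢p′
      xp′ : ω x p′ ≡ ω p p′
      xp′ = anti sk x p′ ▹ (cong -_ (tx p′ p′∈ (p≢p′ ∘ sym)) ▹ sym (anti sk p p′))
      b : Bool
      b = arc T p p′
      right : ω p p′ ≡ sg b
      right = skew-arc T p≢p′
      wrong′ : ω x y ≡ sg (not b)
      wrong′ = skew-arc T x≢y ▹ cong sg (¬-not wrong)
      sg-inj : ∀ b → sg (not b) ≢ sg b
      sg-inj true ()
      sg-inj false ()
      -- Twins have the right arcs to frame vertices, so a wrong arc can only join vertices that
      -- differ from the ones they are twins of.
      p≢x : p ≢ x
      p≢x refl = sg-inj b (sym wrong′ ▹ (py ▹ right))
      p′≢y : p′ ≢ y
      p′≢y refl = sg-inj b (sym wrong′ ▹ (xp′ ▹ right))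
      ≢y : ∀ r → r ∈ vs₀ → r ≢ y
      ≢y r m with r ≟ p′
      ... | yes refl = p′≢y
      ... | no r≢p′ = twin-≢ ty m r≢p′
      strict : Strict (pf ω rest q y)
      strict = replaced-strict fr p′∈ p≢p′ ty p′≢y
      finish : ∀ {a b′} → Twin a p → Twin b′ p → ω a b′ ≡ -1ℤ → a ≢ y → b′ ≢ y →
        ∀ s → ω a y - ω b′ y ≡ + 2 * sg s → ⊥
      finish ta tb ab a≢y b≢y s d = shift-absurd s {pf ω rest q y} strict
        (subst (Within K) (cong₂ (λ t k → pf ω rest q y + t * k) d (apex-pf fr))
          (twins-within ta tb ab (frame-even fr) c (tail-inside fr) (λ r m → tail-≢ fr m)
            (λ r m → q∉ps₀ r (frame-∈ fr (there m))) (here refl) (q∉ps₀ p p∈ ∘ sym)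
            y (λ r m → ≢y r (tail-inside fr r m)) (≢y q (here refl)) a≢y b≢y))
      d₁ : ∀ b → sg b - sg (not b) ≡ + 2 * sg b
      d₁ true = refl
      d₁ false = refl
      d₂ : ∀ b → sg (not b) - sg b ≡ + 2 * sg (not b)
      d₂ true = refl
      d₂ false = refl
      -- The pivot requires `ω a b′ ≡ -1ℤ`, so the arc between `p` and `x` decides their order. The
      -- wrong arc makes `ω p y` and `ω x y` opposite, whence the factor `± 2`.
      contra : ∀ s → arc T p x ≡ s → ⊥
      contra false e = finish (twin-refl p) tx (skew-arc T p≢x ▹ cong sg e) (≢y p (there p∈)) x≢y b
        (cong₂ _-_ (py ▹ right) wrong′ ▹ d₁ b)
      contra true e = finish tx (twin-refl p) (anti sk x p ▹ cong -_ (skew-arc T p≢x ▹ cong sg e)) x≢y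
        (≢y p (there p∈)) (not b) (cong₂ _-_ wrong′ (py ▹ right) ▹ d₂ b)

-- Switching, L, and the theorem

skew-switch : ∀ {n} (T : Tournament n) W x y →
  skew (switch T W) x y ≡ sg (not (W x)) * skew T x y * sg (not (W y))
skew-switch T W x y with x ≟ y
... | yes refl rewrite irrefl (switch T W) x | irrefl T x = lem (sg (not (W x)))
  where
  lem : ∀ s → 0ℤ ≡ s * 0ℤ * s
  lem = solve-∀
... | no x≢y rewrite skew-arc (switch T W) x≢y | skew-arc T x≢y = lem (arc T x y) (W x) (W y)
  where
  lem : ∀ a b c → sg (a xor (b xor c)) ≡ sg (not b) * sg a * sg (not c)
  lem true true true = refl
  lem true true false = refl
  lem true false true = refl
  lem true false false = refl
  lem false true true = refl
  lem false true false = refl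
  lem false false true = refl
  lem false false false = refl

prodFin-sg² : ∀ {n} (g : Fin n → Bool) → prodFin (sg ∘ g) * prodFin (sg ∘ g) ≡ 1ℤ
prodFin-sg² {zero} g = refl
prodFin-sg² {suc n} g =
  lem (sg (g zero)) (prodFin (sg ∘ g ∘ suc)) ▹ cong₂ _*_ (sq (g zero)) (prodFin-sg² (g ∘ suc))
  where
  lem : ∀ a b → (a * b) * (a * b) ≡ (a * a) * (b * b)
  lem = solve-∀
  sq : ∀ b → sg b * sg b ≡ 1ℤ
  sq true = refl
  sq false = refl

-- Switching conjugates every skew-adjacency matrix by a diagonal matrix of signs, whose determinant
-- enters squared.
InD-switch : ∀ {n} k (T : Tournament n) W → InD k T → InD k (switch T W)
InD-switch k T W D m f inj = subst (_≤ + (k ℕ.* k)) (sym eq) (D m f inj)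
  where
  d : Fin m → Bool
  d i = not (W (f i))
  eq : detT (induced (switch T W) f inj) ≡ detT (induced T f inj)
  eq = det-cong (λ i j → skew-switch T W (f i) (f j)) ▹
    (det-scale (sg ∘ d) (sg ∘ d) (skew (induced T f inj)) ▹
    (cong (_* detT (induced T f inj)) (prodFin-sg² d) ▹ ℤ.*-identityˡ _))

blowup⇒xi : ∀ {n h} (H : Tournament h) (T : Tournament n) → SwitchingEquivToTransitiveBlowup H T → InXi H T
blowup⇒xi {n} {h} H T (W , N , B , (b , bsur , barc , _) , (σ , σinj , σsur , σarc)) =
  f , inj , W ∘ f , id , id , (λ y → y , id) , arcs
  where
  f : Fin h → Fin n
  f i = proj₁ (σsur (proj₁ (bsur i)))
  bσf : ∀ i → b (σ (f i)) ≡ i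
  bσf i = proj₂ (bsur i) (proj₂ (σsur (proj₁ (bsur i))) refl)
  inj : Injective _≡_ _≡_ f
  inj {i} {i′} e = sym (bσf i) ▹ (cong (b ∘ σ) e ▹ bσf i′)
  arcs : ∀ i i′ → arc H i i′ ≡ arc (switch T W) (f i) (f i′)
  arcs i i′ with i ≟ i′
  ... | yes refl = irrefl H i ▹ sym (irrefl (switch T W) (f i))
  ... | no i≢i′ = sym (cong₂ (arc H) (bσf i) (bσf i′)) ▹
    (sym (barc (σ (f i)) (σ (f i′)) (λ e → i≢i′ (sym (bσf i) ▹ (e ▹ bσf i′)))) ▹ σarc (f i) (f i′))

extend : ∀ {m n} (f : Fin m → Fin n) → Injective _≡_ _≡_ f → (g : Fin m → Bool) →
  ∃ λ (w : Fin n → Bool) → ∀ i → w (f i) ≡ g i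
extend {m} {n} f inj g = w , correct
  where
  w : Fin n → Bool
  w v with any? (λ i → f i ≟ v)
  ... | yes (i , _) = g i
  ... | no _ = false
  correct : ∀ i → w (f i) ≡ g i
  correct i with any? (λ i′ → f i′ ≟ f i)
  ... | yes (i′ , e) = cong g (inj e)
  ... | no none = ⊥-elim (none (i , refl))

alt : Bool → ℕ → Bool
alt s zero = s
alt s (suc i) = alt (not s) i

alt-even : ∀ i → alt true i ≡ evenᵇ i × alt false i ≡ not (evenᵇ i)
alt-even zero = refl , refl
alt-even (suc i) with p , q ← alt-even i = q , (p ▹ sym (not-involutive (evenᵇ i)))

-- Switching the vertices of odd index in a transitive order reverses exactly the arcs between
-- indices of different parity.
alt-difference : ∀ a b → a ℕ.< b → (a ℕ.<ᵇ b) xor (not (evenᵇ a) xor not (evenᵇ b)) ≡ alt false (b ∸ suc a)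
alt-difference zero (suc b) _ = cong not (not-involutive (evenᵇ b)) ▹ sym (proj₂ (alt-even b))
alt-difference (suc a) (suc b) (ℕ.s≤s a<b) = cong ((a ℕ.<ᵇ b) xor_) (lem (evenᵇ a) (evenᵇ b)) ▹ alt-difference a b a<b
  where
  lem : ∀ x y → not (not x) xor not (not y) ≡ not x xor not y
  lem true y = not-involutive (not y)
  lem false y = refl

module _ {V : Set} where

  AltFrom-tabulate : ∀ {N} (f : V → ℤ) s (g : Fin N → V) → (∀ i → f (g i) ≡ sg (alt s (toℕ i))) →
    AltFrom f s (tabulate g)
  AltFrom-tabulate {zero} f s g e = []
  AltFrom-tabulate {suc N} f s g e = e zero ∷ AltFrom-tabulate f (not s) (g ∘ suc) (e ∘ suc)

  -- The distance is lowered by one because the alternation starts with `false` at distance one.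
  Circ-tabulate : ∀ {N} (ω : Form {V}) (g : Fin N → V) →
    (∀ i j → toℕ i ℕ.< toℕ j → ω (g i) (g j) ≡ sg (alt false (toℕ j ∸ suc (toℕ i)))) → Circ ω (tabulate g)
  Circ-tabulate {zero} ω g e = []
  Circ-tabulate {suc N} ω g e =
    AltFrom-tabulate (ω (g zero)) false (g ∘ suc) (λ i → e zero (suc i) (ℕ.s≤s ℕ.z≤n)) ∷
    Circ-tabulate ω (g ∘ suc) (λ i j i<j → e (suc i) (suc j) (ℕ.s≤s i<j))

-- Switching L along par makes it circulant on the first m + 1 vertices, all dominated by the last one.
par : ∀ m → Fin (suc (suc m)) → Bool
par m a with toℕ a ℕ.≟ suc m
... | yes _ = false
... | no _ = not (evenᵇ (toℕ a))

Carc : ∀ m → Fin (suc (suc m)) → Fin (suc (suc m)) → Bool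
Carc m a b = Larc m a b xor (par m a xor par m b)

toℕ-inject₁-≢ : ∀ {m} (i : Fin (suc m)) → toℕ (inject₁ i) ≢ suc m
toℕ-inject₁-≢ i e = ℕ.<-irrefl (sym (toℕ-inject₁ i) ▹ e) (toℕ<n i)

Carc-circle : ∀ m (i j : Fin (suc m)) → toℕ i ℕ.< toℕ j →
  Carc m (inject₁ i) (inject₁ j) ≡ alt false (toℕ j ∸ suc (toℕ i))
Carc-circle m i j i<j with toℕ (inject₁ i) ℕ.≟ suc m | toℕ (inject₁ j) ℕ.≟ suc m
... | yes e | _ = ⊥-elim (toℕ-inject₁-≢ i e)
... | no _ | yes e = ⊥-elim (toℕ-inject₁-≢ j e)
... | no _ | no _ rewrite toℕ-inject₁ i | toℕ-inject₁ j = alt-difference (toℕ i) (toℕ j) i<j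

Carc-apex : ∀ m (i : Fin (suc m)) → Carc m (inject₁ i) (fromℕ (suc m)) ≡ false
Carc-apex m i with toℕ (inject₁ i) ℕ.≟ suc m | toℕ (fromℕ (suc m)) ℕ.≟ suc m
... | yes e | _ = ⊥-elim (toℕ-inject₁-≢ i e)
... | no _ | no e = ⊥-elim (e (toℕ-fromℕ (suc m)))
... | no _ | yes _ = lem (not (evenᵇ (toℕ (inject₁ i))))
  where
  lem : ∀ b → b xor (b xor false) ≡ false
  lem true = refl
  lem false = refl

-- Assembling the blowup

module Blowup {n} (T : Tournament n) (j : ℕ) (j>0 : 0 ℕ.< j) (D : InD (suc (j ℕ.+ j)) T)
  (ℓ : Fin (suc (suc (j ℕ.+ j))) → Fin n) (ℓ-inj : Injective _≡_ _≡_ ℓ) (w : Fin n → Bool)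
  (arc-ℓ : ∀ a b → arc (switch T w) (ℓ a) (ℓ b) ≡ Carc (j ℕ.+ j) a b)
  where

  m : ℕ
  m = j ℕ.+ j

  T₁ : Tournament n
  T₁ = switch T w

  ps : List (Fin n)
  ps = tabulate (ℓ ∘ inject₁)

  q : Fin n
  q = ℓ (fromℕ (suc m))

  inject₁-≢ : ∀ (i i′ : Fin (suc m)) → toℕ i ℕ.< toℕ i′ → ℓ (inject₁ i) ≢ ℓ (inject₁ i′)
  inject₁-≢ i i′ i<i′ e = ℕ.<-irrefl (sym (toℕ-inject₁ i) ▹ (cong toℕ (ℓ-inj e) ▹ toℕ-inject₁ i′)) i<i′

  apex-≢ : ∀ (i : Fin (suc m)) → ℓ (inject₁ i) ≢ q
  apex-≢ i e = toℕ-inject₁-≢ i (cong toℕ (ℓ-inj e) ▹ toℕ-fromℕ (suc m))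

  circ₁ : Circ (skew T₁) ps
  circ₁ = Circ-tabulate (skew T₁) (ℓ ∘ inject₁) (λ i i′ i<i′ →
    skew-arc T₁ (inject₁-≢ i i′ i<i′) ▹ cong sg (arc-ℓ (inject₁ i) (inject₁ i′) ▹ Carc-circle m i i′ i<i′))

  apex₁ : ∀ p → p ∈ ps → skew T₁ p q ≡ -1ℤ
  apex₁ p p∈ with i , refl ← ∈-tabulate⁻ {f = ℓ ∘ inject₁} p∈ =
    skew-arc T₁ (apex-≢ i) ▹ cong sg (arc-ℓ (inject₁ i) (fromℕ (suc m)) ▹ Carc-apex m i)

  size : length ps ≡ suc (j ℕ.+ j)
  size = length-tabulate (ℓ ∘ inject₁)

  D₁ : InD (suc (j ℕ.+ j)) T₁
  D₁ = InD-switch (suc (j ℕ.+ j)) T w D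

  module F₁ = Frames T₁ j D₁ ps q circ₁ size apex₁

  ℓ∈ : ∀ a → ℓ a ∈ q ∷ ps
  ℓ∈ a with view a
  ... | ‵fromℕ = here refl
  ... | ‵inject₁ i = there (∈-tabulate⁺ {f = ℓ ∘ inject₁} i)

  ∈ℓ : ∀ {v} → v ∈ q ∷ ps → ∃ λ a → v ≡ ℓ a
  ∈ℓ (here refl) = fromℕ (suc m) , refl
  ∈ℓ (there v∈) with i , e ← ∈-tabulate⁻ {f = ℓ ∘ inject₁} v∈ = inject₁ i , e

  -- `own` puts every vertex of the copy into its own block with positive sign. This makes all
  -- blocks non-empty and keeps the copy unchanged when the signs are switched away.
  record Block (x : Fin n) : Set where
    field
      index   : Fin (suc (suc m))
      sgn     : Bool
      similar : F₁.Similar sgn x (ℓ index)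
      own     : ∀ a → x ≡ ℓ a → index ≡ a × sgn ≡ true

  outside : ∀ {x} → ¬ ∃ (λ a → ℓ a ≡ x) → ∀ r → r ∈ q ∷ ps → r ≢ x
  outside none r r∈ e with a , e′ ← ∈ℓ r∈ = none (a , (sym e′ ▹ e))

  block : ∀ x → Block x
  block x with any? (λ a → ℓ a ≟ x)
  ... | yes (a , refl) = record
    { index = a ; sgn = true ; similar = λ r _ _ → sym (ℤ.*-identityˡ _) ; own = λ b e → ℓ-inj e , refl }
  ... | no none with p , p∈ , ε , sim ← F₁.Vertex.clone x (outside none)
    with a , refl ← ∈ℓ p∈ = record
    { index = a ; sgn = ε ; similar = sim ; own = λ b e → ⊥-elim (none (b , sym e)) }

  β : Fin n → Fin (suc (suc m))
  β x = Block.index (block x)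

  ε : Fin n → Bool
  ε x = Block.sgn (block x)

  β-ℓ : ∀ a → β (ℓ a) ≡ a
  β-ℓ a = proj₁ (Block.own (block (ℓ a)) a refl)

  ε-ℓ : ∀ a → ε (ℓ a) ≡ true
  ε-ℓ a = proj₂ (Block.own (block (ℓ a)) a refl)

  T₂ : Tournament n
  T₂ = switch T₁ (not ∘ ε)

  skew₂ : ∀ x y → skew T₂ x y ≡ sg (ε x) * skew T₁ x y * sg (ε y)
  skew₂ x y = skew-switch T₁ (not ∘ ε) x y ▹
    cong₂ (λ a b → sg a * skew T₁ x y * sg b) (not-involutive (ε x)) (not-involutive (ε y))

  skew₂-ℓ : ∀ {r} x → r ∈ q ∷ ps → skew T₂ r x ≡ skew T₁ r x * sg (ε x)
  skew₂-ℓ x r∈ with a , refl ← ∈ℓ r∈ = skew₂ (ℓ a) x ▹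
    (cong (λ t → sg t * skew T₁ (ℓ a) x * sg (ε x)) (ε-ℓ a) ▹
    cong (_* sg (ε x)) (ℤ.*-identityˡ (skew T₁ (ℓ a) x)))

  skew₂-ℓℓ : ∀ {r s} → r ∈ q ∷ ps → s ∈ q ∷ ps → skew T₂ r s ≡ skew T₁ r s
  skew₂-ℓℓ {r} r∈ s∈ with a , refl ← ∈ℓ s∈ = skew₂-ℓ (ℓ a) r∈ ▹
    (cong (λ t → skew T₁ r (ℓ a) * sg t) (ε-ℓ a) ▹ ℤ.*-identityʳ _)

  -- The same circle and apex serve again after the signs have been switched away; now all
  -- similarities are genuine twins.
  module F₂ = Frames T₂ j (InD-switch (suc (j ℕ.+ j)) T₁ (not ∘ ε) D₁) ps q
    (Circ-cong (λ p r p∈ r∈ → skew₂-ℓℓ (there p∈) (there r∈)) circ₁) size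
    (λ p p∈ → skew₂-ℓℓ (there p∈) (here refl) ▹ apex₁ p p∈)

  twin : ∀ x → F₂.Twin x (ℓ (β x))
  twin x r r∈ r≢ = skew₂-ℓ x r∈ ▹
    (cong (_* sg (ε x)) (Block.similar (block x) r r∈ r≢) ▹
    (lem (ε x) (skew T₁ r (ℓ (β x))) ▹ sym (skew₂-ℓℓ r∈ (ℓ∈ (β x)))))
    where
    l₁ : ∀ a → 1ℤ * a * 1ℤ ≡ a
    l₁ = solve-∀
    l₂ : ∀ a → -1ℤ * a * -1ℤ ≡ a
    l₂ = solve-∀
    lem : ∀ s a → sg s * a * sg s ≡ a
    lem true a = l₁ a
    lem false a = l₂ a

  arc₂-ℓ : ∀ a b → arc T₂ (ℓ a) (ℓ b) ≡ Carc m a b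
  arc₂-ℓ a b = cong₂ (λ s t → arc T₁ (ℓ a) (ℓ b) xor (not s xor not t)) (ε-ℓ a) (ε-ℓ b) ▹
    (xor-identityʳ _ ▹ arc-ℓ a b)

  arc₂-blocks : ∀ x y → β x ≢ β y → arc T₂ x y ≡ arc T₂ (ℓ (β x)) (ℓ (β y))
  arc₂-blocks x y ne = cases (ℓ∈ (β x)) (ℓ∈ (β y))
    where
    x≢y : x ≢ y
    x≢y e = ne (cong β e)
    ℓ≢ : ℓ (β x) ≢ ℓ (β y)
    ℓ≢ e = ne (ℓ-inj e)
    cases : ℓ (β x) ∈ q ∷ ps → ℓ (β y) ∈ q ∷ ps → arc T₂ x y ≡ arc T₂ (ℓ (β x)) (ℓ (β y))
    cases (there x∈) y∈ = F₂.twins-arc j>0 x∈ y∈ ℓ≢ (twin x) (twin y) x≢y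
    cases (here e) (here d) = ⊥-elim (ℓ≢ (e ▹ sym d))
    -- `twins-arc` wants its first vertex on the circle, so an apex in first position is handled
    -- through the reversed arc.
    cases x∈@(here _) (there y∈) = oneArc T₂ x y x≢y ▹
      (cong not (F₂.twins-arc j>0 y∈ x∈ (ℓ≢ ∘ sym) (twin y) (twin x) (x≢y ∘ sym)) ▹
      sym (oneArc T₂ (ℓ (β x)) (ℓ (β y)) ℓ≢))

  -- Three switchings in one: to the circulant form, away from the signs `ε`, and back along `par`.
  -- The last is constant on blocks, so it restores the arcs of `L` between blocks without touching
  -- the arcs inside them.
  W : Fin n → Bool
  W x = w x xor (not (ε x) xor par m (β x))

  T₃ : Tournament n
  T₃ = switch T W

  arc₃ : ∀ x y → arc T₃ x y ≡ arc T₂ x y xor (par m (β x) xor par m (β y))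
  arc₃ x y = solve 7 (λ a b c d e f g →
      a :+ ((b :+ (c :+ d)) :+ (e :+ (f :+ g))) := ((a :+ (b :+ e)) :+ (c :+ f)) :+ (d :+ g)) refl
      (arc T x y) (w x) (not (ε x)) (par m (β x)) (w y) (not (ε y)) (par m (β y))
    where open xor-∧-Solver

  arc₃-blocks : ∀ x y → β x ≢ β y → arc T₃ x y ≡ Larc m (β x) (β y)
  arc₃-blocks x y ne = arc₃ x y ▹
    (cong (_xor (par m (β x) xor par m (β y))) (arc₂-blocks x y ne ▹ arc₂-ℓ (β x) (β y)) ▹
    cancel (Larc m (β x) (β y)) (par m (β x) xor par m (β y)))
    where
    cancel : ∀ a b → (a xor b) xor b ≡ a
    cancel true true = refl
    cancel true false = refl
    cancel false true = refl
    cancel false false = refl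

  arc₃-same : ∀ x y → β x ≡ β y → arc T₃ x y ≡ arc T₂ x y
  arc₃-same x y e = arc₃ x y ▹
    (cong (λ b → arc T₂ x y xor (par m (β x) xor par m b)) (sym e) ▹
    (cong (arc T₂ x y xor_) (xor-same (par m (β x))) ▹ xor-identityʳ _))

  arc-true-≢ : ∀ {x y} → arc T₂ x y ≡ true → x ≢ y
  arc-true-≢ {x} e refl with () ← sym e ▹ irrefl T₂ x

  transitive₂ : ∀ u v x → β u ≡ β v → β v ≡ β x → arc T₂ u v ≡ true → arc T₂ v x ≡ true → arc T₂ u x ≡ true
  transitive₂ u v x e d uv vx with arc T₂ u x in ux
  ... | true = refl
  ... | false = ⊥-elim (F₂.no-cyclic-twins (ℓ∈ (β u)) (twin u)
      (subst (F₂.Twin v ∘ ℓ) (sym e) (twin v)) (subst (F₂.Twin x ∘ ℓ) (sym (e ▹ d)) (twin x))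
      (value uv) (value vx) (value (oneArc T₂ x u (u≢x ∘ sym) ▹ cong not ux)))
    where
    value : ∀ {a b} → arc T₂ a b ≡ true → skew T₂ a b ≡ 1ℤ
    value t = skew-arc T₂ (arc-true-≢ t) ▹ cong sg t
    u≢x : u ≢ x
    u≢x refl with () ← sym uv ▹ (oneArc T₂ u v (arc-true-≢ uv) ▹ cong not vx)

  blowup : SwitchingEquivToTransitiveBlowup (L m) T
  blowup = W , n , T₃ ,
    (β , (λ a → ℓ a , λ { refl → β-ℓ a }) , arc₃-blocks , transitive₃) ,
    (id , id , (λ y → y , id) , λ _ _ → refl)
    where
    transitive₃ : ∀ u v x → β u ≡ β v → β v ≡ β x → arc T₃ u v ≡ true → arc T₃ v x ≡ true → arc T₃ u x ≡ true
    transitive₃ u v x e d uv vx = arc₃-same u x (e ▹ d) ▹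
      transitive₂ u v x e d (sym (arc₃-same u v e) ▹ uv) (sym (arc₃-same v x d) ▹ vx)

xi⇒blowup : ∀ j → 0 ℕ.< j → ∀ {n} (T : Tournament n) → InD (suc (j ℕ.+ j)) T →
  InXi (L (j ℕ.+ j)) T → SwitchingEquivToTransitiveBlowup (L (j ℕ.+ j)) T
xi⇒blowup j j>0 {n} T D (f , inj , W , σ , σinj , σsur , σarc)
  -- The given switching of the copy is combined with `par`, transported along `σ`, to reach the
  -- circulant form directly; off the copy the extension is arbitrary.
  with w , wf ← extend f inj (λ i → W i xor par (j ℕ.+ j) (σ i)) =
  Blowup.blowup T j j>0 D (f ∘ τ) ℓ-inj w arc-ℓ
  where
  m : ℕ
  m = j ℕ.+ j
  τ : Fin (suc (suc m)) → Fin (suc (suc m))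
  τ a = proj₁ (σsur a)
  στ : ∀ a → σ (τ a) ≡ a
  στ a = proj₂ (σsur a) refl
  ℓ-inj : Injective _≡_ _≡_ (f ∘ τ)
  ℓ-inj {a} {b} e = sym (στ a) ▹ (cong σ (inj e) ▹ στ b)
  arc-ℓ : ∀ a b → arc (switch T w) (f (τ a)) (f (τ b)) ≡ Carc m a b
  arc-ℓ a b = cong₂ (λ s t → arc T (f (τ a)) (f (τ b)) xor (s xor t)) (wf (τ a)) (wf (τ b)) ▹
    (solve 5 (λ a b c d e → a :+ ((b :+ c) :+ (d :+ e)) := (a :+ (b :+ d)) :+ (c :+ e)) refl
      (arc T (f (τ a)) (f (τ b))) (W (τ a)) (par m (σ (τ a))) (W (τ b)) (par m (σ (τ b))) ▹
    (cong (_xor (par m (σ (τ a)) xor par m (σ (τ b)))) (sym (σarc (τ a) (τ b))) ▹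
    cong₂ (Carc m) (στ a) (στ b)))
    where open xor-∧-Solver

theorem7p1 : (k : ℕ) → 7 ℕ.≤ k → ∃ (λ j → k ≡ 2 ℕ.* j ℕ.+ 1) →
    (n : ℕ) (T : Tournament n) → InD k T → ¬ InD (k ∸ 2) T →
    (SwitchingEquivToTransitiveBlowup (L (k ∸ 1)) T ⇔ InXi (L (k ∸ 1)) T)
theorem7p1 k 7≤k (j , e) n T D _
  -- Rewriting `k` as `suc (j ℕ.+ j)` lets `k ∸ 1` compute to `j ℕ.+ j`.
  with refl ← e ▹ (ℕ.+-comm (2 ℕ.* j) 1 ▹ cong (λ t → suc (j ℕ.+ t)) (ℕ.+-identityʳ j)) =
  mk⇔ (blowup⇒xi (L (j ℕ.+ j)) T) (xi⇒blowup j (positive j 7≤k) T D)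
  where
  positive : ∀ j → 7 ℕ.≤ suc (j ℕ.+ j) → 0 ℕ.< j
  positive zero (ℕ.s≤s ())
  positive (suc j) _ = ℕ.s≤s ℕ.z≤n
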